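{- Let $G=(V,E)$ be a finite graph, let $A,B\subseteq E$ be chosen independently and uniformly at random and let $\Delta$ be the event that $A\bigtriangleup B$ is eulerian. Then $$\mathrm{Bias}(|A|+|B|\equiv |E|+1\ (\mathrm{mod}\ 3)\mid\Delta)=\mathrm{Bias}(|A|+|B|\equiv |E|+2\ (\mathrm{mod}\ 3)\mid\Delta)$$ and $$\frac{\mathrm{Bias}(|A|+|B|\equiv |E|\ (\mathrm{mod}\ 3)\mid\Delta)-\mathrm{Bias}(|A|+|B|\equiv |E|+1\ (\mathrm{mod}\ 3)\mid\Delta)}{\mathrm{Bias}(|A|+|B|\equiv |E|\ (\mathrm{mod}\ 3))-\mathrm{Bias}(|A|+|B|\equiv |E|+1\ (\mathrm{mod}\ 3))}=4^{r(G)}(-3)^{n(G)}\,T\!\left(G;-\tfrac{1}{2},-\tfrac{1}{3}\right).$$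
   Context: Graphs are finite; loops and parallel edges are permitted. A subset $A\subseteq E$ is identified with the subgraph $(V,A)$ of $G$; it is called eulerian if all its vertex degrees are even (a loop contributes 2 to the degree). $\bigtriangleup$ is symmetric difference of sets. For $A\subseteq E$, $r(A)=|V|-k(A)$, where $k(A)$ is the number of connected components of $(V,A)$; $r(G)=r(E)$ and $n(G)=|E|-r(G)$. The Tutte polynomial is $T(G;x,y)=\sum_{A\subseteq E}(x-1)^{r(E)-r(A)}(y-1)^{|A|-r(A)}$. For an event $\Sigma$, $\mathrm{Bias}(\Sigma)=\mathbb{P}(\Sigma)-\mathbb{P}(\overline{\Sigma})$ and $\mathrm{Bias}(\Sigma\mid\Delta)=\mathbb{P}(\Sigma\mid\Delta)-\mathbb{P}(\overline{\Sigma}\mid\Delta)$, where $\overline{\Sigma}$ is the complement of $\Sigma$. -}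

module Defs where

open import Level using (0ℓ)
open import Data.Bool.Base using (true; false)
open import Data.Empty using (⊥-elim)
open import Data.Nat.Base as ℕ using (ℕ; zero; suc; _∸_)
open import Data.Nat.Divisibility using (_∣?_; _∣0) renaming (_∣_ to _divides_)
open import Data.Nat.DivMod using (_%_)
import Data.Nat.Properties as ℕ
open import Data.Integer.Base using (+_)
open import Data.Rational using (ℚ; NonZero; 0ℚ; 1ℚ; _+_; _*_; _-_; _/_; _÷_)
open import Data.Rational.Base using (+-*-rawSemiring)
open import Data.Rational.Properties using (pos⇒nonZero; normalize-pos)
open import Data.Fin.Base using (Fin; zero; suc; punchIn; punchOut)
open import Data.Fin.Properties using (_≟_; all?; punchOut-cong; punchOut-injective; punchOut-punchIn; punchInᵢ≢i)
open import Data.Fin.Subset using (Subset; inside; outside; ⊤; ⊥; _∈_; _∪_; _∩_; _─_; ∣_∣)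
open import Data.Fin.Subset.Properties using (∩-zeroˡ; ∣⊥∣≡0)
open import Data.Vec.Base using ([]; _∷_; here; there; tabulate)
open import Data.List.Base as List using (List; length; map; foldr; filter; cartesianProduct)
import Data.List.Membership.Propositional as List
open import Data.List.Membership.Propositional.Properties
  using (∈-++⁺ˡ; ∈-++⁺ʳ; ∈-map⁺; ∈-filter⁺; ∈-cartesianProduct⁺)
open import Data.List.Relation.Unary.Any using (here; there)
open import Data.Product using (∃; ∃-syntax; _×_; _,_; proj₁; proj₂)
open import Data.Sum using (inj₁; inj₂)
open import Function.Base using (_∘_)
open import Function.Definitions using (Surjective)
open import Relation.Binary.Core using (Rel)
open import Relation.Binary.PropositionalEquality
  using (_≡_; _≢_; refl; sym; trans; cong; cong₂; subst; isEquivalence)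
open import Relation.Binary.Construct.Closure.Equivalence as Eq using (EqClosure)
open import Relation.Binary.Construct.Closure.ReflexiveTransitive using (ε; _◅_; _◅◅_)
open import Relation.Binary.Construct.Closure.Symmetric using (fwd; bwd)
open import Relation.Nullary using (yes; no; does)
open import Relation.Unary using (Pred; Decidable) renaming (_∩_ to _∩ᵖ_)
open import Relation.Unary.Properties using (∁?; _∩?_)

open import Algebra.Definitions.RawSemiring +-*-rawSemiring public using (_^_)

-- Each edge carries an ordered pair of end vertices; degrees and
-- connectivity do not depend on the order.  Equal ends give a loop, repeated
-- pairs parallel edges.
record Graph : Set where
  field
    #V   : ℕ
    #E   : ℕ
    ends : Fin #E → Fin #V × Fin #V

open Graph public

Adjacent : ∀ {n m} → (Fin m → Fin n × Fin n) → Subset m → Rel (Fin n) 0ℓ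
Adjacent η A u v = ∃[ e ] e ∈ A × η e ≡ (u , v)

Connected : ∀ {n m} → (Fin m → Fin n × Fin n) → Subset m → Rel (Fin n) 0ℓ
Connected η A = EqClosure (Adjacent η A)

-- A bijection between the equivalence classes of _~_ and Fin k; such a k is
-- therefore unique.
record Classes {n} (_~_ : Rel (Fin n) 0ℓ) (k : ℕ) : Set where
  field
    class      : Fin n → Fin k
    surjective : Surjective _≡_ _≡_ class
    sound      : ∀ {u v} → u ~ v → class u ≡ class v
    complete   : ∀ {u v} → class u ≡ class v → u ~ v

module _ {n m} (η : Fin (suc m) → Fin n × Fin n) (A : Subset m) where

  private
    s = proj₁ (η zero)
    t = proj₂ (η zero)

    weaken : ∀ {b u v} → Connected (η ∘ suc) A u v → Connected η (b ∷ A) u v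
    weaken = Eq.map λ (e , e∈A , eq) → suc e , there e∈A , eq

  skipEdge : ∀ {k} → Classes (Connected (η ∘ suc) A) k → Classes (Connected η (outside ∷ A)) k
  skipEdge C = record
    { class      = class
    ; surjective = surjective
    ; sound      = Eq.gfold isEquivalence class λ where
        (suc e , there e∈A , eq) → sound (Eq.return (e , e∈A , eq))
    ; complete   = weaken ∘ complete
    } where open Classes C

  redundantEdge : ∀ {k} (C : Classes (Connected (η ∘ suc) A) k) →
                  Classes.class C s ≡ Classes.class C t →
                  Classes (Connected η (inside ∷ A)) k
  redundantEdge C s≡t = record
    { class      = class
    ; surjective = surjective
    ; sound      = Eq.gfold isEquivalence class λ where
        (zero  , here      , refl) → s≡t
        (suc e , there e∈A , eq)   → sound (Eq.return (e , e∈A , eq))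
    ; complete   = weaken ∘ complete
    } where open Classes C

  mergingEdge : ∀ {k} (C : Classes (Connected (η ∘ suc) A) (suc k)) →
                Classes.class C s ≢ Classes.class C t →
                Classes (Connected η (inside ∷ A)) k
  mergingEdge {k} C s≢t = record
    { class      = class′
    ; surjective = surj
    ; sound      = Eq.gfold isEquivalence class′ λ where
        (zero  , here      , refl) → joined
        (suc e , there e∈A , eq)   → class′-cong (sound (Eq.return (e , e∈A , eq)))
    ; complete   = compl _ _
    }
    where
    open Classes C

    merge : Fin (suc k) → Fin k
    merge c with class t ≟ c
    ... | yes _   = punchOut (s≢t ∘ sym)
    ... | no  t≢c = punchOut t≢c

    class′ : Fin n → Fin k
    class′ = merge ∘ class

    class′-cong : ∀ {u v} → class u ≡ class v → class′ u ≡ class′ v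
    class′-cong = cong merge

    joined : class′ s ≡ class′ t
    joined with class t ≟ class s | class t ≟ class t
    ... | yes _ | yes _   = refl
    ... | no  _ | yes _   = punchOut-cong (class t) refl
    ... | _     | no  t≢t = ⊥-elim (t≢t refl)

    merge-punchIn : ∀ c → merge (punchIn (class t) c) ≡ c
    merge-punchIn c with class t ≟ punchIn (class t) c
    ... | yes eq = ⊥-elim (punchInᵢ≢i (class t) c (sym eq))
    ... | no  _  = trans (punchOut-cong (class t) refl) (punchOut-punchIn (class t))

    surj : Surjective _≡_ _≡_ class′
    surj c with surjective (punchIn (class t) c)
    ... | v , hits = v , λ { refl → trans (cong merge (hits refl)) (merge-punchIn c) }

    st : Connected η (inside ∷ A) s t
    st = Eq.return (zero , here , refl)

    ts : Connected η (inside ∷ A) t s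
    ts = bwd (zero , here , refl) ◅ ε

    compl : ∀ u v → class′ u ≡ class′ v → Connected η (inside ∷ A) u v
    compl u v eq with class t ≟ class u | class t ≟ class v
    ... | yes t~u | yes t~v = weaken (complete (trans (sym t~u) t~v))
    ... | yes t~u | no  t≁v = weaken (complete (sym t~u)) ◅◅ ts ◅◅
                              weaken (complete (punchOut-injective _ t≁v eq))
    ... | no  t≁u | yes t~v = weaken (complete (punchOut-injective t≁u _ eq)) ◅◅ st ◅◅
                              weaken (complete t~v)
    ... | no  t≁u | no  t≁v = weaken (complete (punchOut-injective t≁u t≁v eq))

addEdge : ∀ {n m k} (η : Fin (suc m) → Fin n × Fin n) (A : Subset m) →
          Classes (Connected (η ∘ suc) A) k → ∃ (Classes (Connected η (inside ∷ A)))
addEdge {k = k} η A C with Classes.class C (proj₁ (η zero)) ≟ Classes.class C (proj₂ (η zero))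
... | yes s≡t = k , redundantEdge η A C s≡t
addEdge {k = zero}  η A C | no _ with () ← Classes.class C (proj₁ (η zero))
addEdge {k = suc k} η A C | no s≢t = k , mergingEdge η A C s≢t

components : ∀ {n m} (η : Fin m → Fin n × Fin n) (A : Subset m) → ∃ (Classes (Connected η A))
components {n} η [] = n , record
  { class      = λ v → v
  ; surjective = λ v → v , λ eq → eq
  ; sound      = Eq.fold isEquivalence λ where (() , _)
  ; complete   = λ where refl → ε
  }
components η (outside ∷ A) = _ , skipEdge η A (proj₂ (components (η ∘ suc) A))
components η (inside  ∷ A) = addEdge η A (proj₂ (components (η ∘ suc) A))

k : (G : Graph) → Subset (#E G) → ℕ
k G A = proj₁ (components (ends G) A)

-- The truncated subtractions below never truncate:
-- k(A) ≤ |V|, r(A) ≤ r(E) and r(A) ≤ |A|.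
r : (G : Graph) → Subset (#E G) → ℕ
r G A = #V G ∸ k G A

rank : Graph → ℕ
rank G = r G ⊤

nullity : Graph → ℕ
nullity G = #E G ∸ rank G

subsets : ∀ m → List (Subset m)
subsets zero    = List.[ [] ]
subsets (suc m) = map (outside ∷_) (subsets m) List.++ map (inside ∷_) (subsets m)

∑⊆ : ∀ {m} → (Subset m → ℚ) → ℚ
∑⊆ {m} f = foldr _+_ 0ℚ (map f (subsets m))

Tutte : Graph → ℚ → ℚ → ℚ
Tutte G x y = ∑⊆ λ A → (x - 1ℚ) ^ (rank G ∸ r G A) * (y - 1ℚ) ^ (∣ A ∣ ∸ r G A)

-- Edges are counted once at each of their two ends, so a loop contributes 2.
degree : (G : Graph) → Subset (#E G) → Fin (#V G) → ℕ
degree G A v = ∣ A ∩ tabulate (λ e → does (proj₁ (ends G e) ≟ v)) ∣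
         ℕ.+ ∣ A ∩ tabulate (λ e → does (proj₂ (ends G e) ≟ v)) ∣

Eulerian : (G : Graph) → Pred (Subset (#E G)) 0ℓ
Eulerian G A = ∀ v → 2 divides degree G A v

eulerian? : (G : Graph) → Decidable (Eulerian G)
eulerian? G A = all? λ v → 2 ∣? degree G A v

infixr 6 _△_
_△_ : ∀ {m} → Subset m → Subset m → Subset m
A △ B = (A ─ B) ∪ (B ─ A)

Event : ∀ m → Pred (Subset m × Subset m) 0ℓ → Set
Event m P = Decidable P

-- Choosing two subsets independently and uniformly is the uniform distribution
-- on all ordered pairs; each pair occurs in the list exactly once.
pairs : ∀ m → List (Subset m × Subset m)
pairs m = cartesianProduct (subsets m) (subsets m)

∈-subsets : ∀ {m} (A : Subset m) → A List.∈ subsets m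
∈-subsets []            = here refl
∈-subsets (outside ∷ A) = ∈-++⁺ˡ (∈-map⁺ (outside ∷_) (∈-subsets A))
∈-subsets {suc m} (inside ∷ A) =
  ∈-++⁺ʳ (map (outside ∷_) (subsets m)) (∈-map⁺ (inside ∷_) (∈-subsets A))

∈-pairs : ∀ {m} (ω : Subset m × Subset m) → ω List.∈ pairs m
∈-pairs (A , B) = ∈-cartesianProduct⁺ (∈-subsets A) (∈-subsets B)

length-nonZero : ∀ {X : Set} {x} {xs : List X} → x List.∈ xs → ℕ.NonZero (length xs)
length-nonZero (here _)  = _
length-nonZero (there _) = _

pairs-nonZero : ∀ m → ℕ.NonZero (length (pairs m))
pairs-nonZero m = length-nonZero (∈-pairs {m} (⊥ , ⊥))

ℙ[_] : ∀ {m P} → Event m P → ℚ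
ℙ[_] {m} S = (+ length (filter S (pairs m)) / length (pairs m)) {{pairs-nonZero m}}

ℙ-nonZero : ∀ {m P} (S : Event m P) {ω} → P ω → NonZero ℙ[ S ]
ℙ-nonZero {m} S {ω} Pω = pos⇒nonZero ℙ[ S ] {{normalize-pos (length (filter S (pairs m))) (length (pairs m))
  {{pairs-nonZero m}} {{length-nonZero (∈-filter⁺ S (∈-pairs ω) Pω)}}}}

ℙ[_∣_] : ∀ {m P Q} (S : Event m P) (D : Event m Q) → .{{NonZero ℙ[ D ]}} → ℚ
ℙ[ S ∣ D ] = ℙ[ S ∩? D ] ÷ ℙ[ D ]

Bias[_] : ∀ {m P} → Event m P → ℚ
Bias[ S ] = ℙ[ S ] - ℙ[ ∁? S ]

Bias[_∣_] : ∀ {m P Q} (S : Event m P) (D : Event m Q) → .{{NonZero ℙ[ D ]}} → ℚ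
Bias[ S ∣ D ] = ℙ[ S ∣ D ] - ℙ[ ∁? S ∣ D ]

Total≡ : (G : Graph) → ℕ → Pred (Subset (#E G) × Subset (#E G)) 0ℓ
Total≡ G c (A , B) = (∣ A ∣ ℕ.+ ∣ B ∣) % 3 ≡ c % 3

total≡ : (G : Graph) (c : ℕ) → Event (#E G) (Total≡ G c)
total≡ G c (A , B) = (∣ A ∣ ℕ.+ ∣ B ∣) % 3 ℕ.≟ c % 3

EulerianDifference : (G : Graph) → Pred (Subset (#E G) × Subset (#E G)) 0ℓ
EulerianDifference G (A , B) = Eulerian G (A △ B)

Δ : (G : Graph) → Event (#E G) (EulerianDifference G)
Δ G (A , B) = eulerian? G (A △ B)

⊥△⊥≡⊥ : ∀ m → ⊥ {m} △ ⊥ ≡ ⊥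
⊥△⊥≡⊥ zero    = refl
⊥△⊥≡⊥ (suc m) = cong (outside ∷_) (⊥△⊥≡⊥ m)

∣⊥∩A∣≡0 : ∀ {m} (A : Subset m) → ∣ ⊥ ∩ A ∣ ≡ 0
∣⊥∩A∣≡0 {m} A = trans (cong ∣_∣ (∩-zeroˡ A)) (∣⊥∣≡0 m)

⊥-eulerian : (G : Graph) → Eulerian G ⊥
⊥-eulerian G v = subst (2 divides_) (sym (cong₂ ℕ._+_ (∣⊥∩A∣≡0 {#E G} _) (∣⊥∩A∣≡0 {#E G} _))) (2 ∣0)

Δ-nonZero : ∀ G → NonZero ℙ[ Δ G ]
Δ-nonZero G = ℙ-nonZero (Δ G) {⊥ , ⊥}
  (subst (Eulerian G) (sym (⊥△⊥≡⊥ (#E G))) (⊥-eulerian G))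

{-# OPTIONS --safe #-}
module Submission where

-- Let ω be a primitive cube root of unity.  In Σ ω^(|A| + |B|) over the pairs
-- with A △ B = C an edge of C contributes 2ω and any other edge 1 + ω² = -ω, so
-- the sum is ω^|E| 2^|C| (-1)^(|E| - |C|).  Hence both claims reduce to the sum
-- W of 2^|C| (-1)^(|E| - |C|) over the eulerian C and to P(Δ) = 2^(-r(G)).
--
-- Detecting eulerian sets by the characters Π_{v ∈ S} (-1)^(deg v), S ⊆ V, gives
--   2^|V| Σ_{C eulerian} p^|C| q^(|E| - |C|)
--     = Σ_S Π_e (q ± p) = Σ_A (2p)^|A| (q - p)^(|E| - |A|) 2^k(A),
-- the sign being + when S does not separate the ends of e; there are 2^k(A) sets
-- S that separate no edge of A.  Taking p = q = 1 yields P(Δ), while p = 2,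
-- q = -1 yields the Tutte polynomial on the hyperbola (x - 1)(y - 1) = 2.

module Enumeration where

  open import Defs
  open import Algebra.Bundles using (CommutativeRing)
  open import Data.Bool.Base using (Bool; true; false; if_then_else_)
  import Data.Bool.Properties as Bool
  open import Data.Fin.Base as Fin using (Fin; zero; suc)
  open import Data.Fin.Properties using (_≟_; all?; injective⇒≤)
  open import Data.Fin.Subset using (Subset; inside; outside; ⊤; ∁; ∣_∣)
  open import Data.Fin.Subset.Properties using (∣p∣≤n; ∣∁p∣≡n∸∣p∣; ∈⊤)
  import Data.Integer.Base as ℤ
  import Data.Integer.Properties as ℤ
  open import Data.List.Base using (List; []; _∷_; map; foldr; filter; length; _++_; cartesianProduct)
  open import Data.Nat.Base as ℕ using (ℕ; zero; suc; _∸_)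
  open import Data.Nat.Divisibility using (_∣?_; ∣m+n∣m⇒∣n; ∣m∣n⇒∣m+n; ∣-refl)
  open import Data.Nat.DivMod using (_%_)
  import Data.Nat.Properties as ℕ
  open import Data.Product using (_×_; _,_; proj₁; proj₂)
  open import Data.Rational.Base
    using (ℚ; NonZero; 0ℚ; 1ℚ; ½; -½; _+_; _-_; _*_; -_; _/_; _÷_; 1/_; ≢-nonZero)
  open import Data.Rational.Properties
    using ( +-*-commutativeRing; +-identityˡ; +-identityʳ; +-assoc; *-zeroˡ; *-zeroʳ; *-identityˡ
          ; *-identityʳ; *-assoc; *-comm; *-inverseˡ; *-inverseʳ; *-distribˡ-+; *-distribʳ-+
          ; toℚᵘ-injective; toℚᵘ-fromℚᵘ; toℚᵘ-homo-+; toℚᵘ-homo-*)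
  import Data.Rational.Unnormalised.Base as ℚᵘ
  import Data.Rational.Unnormalised.Properties as ℚᵘ
  open import Data.Rational.Solver using (module +-*-Solver)
  open import Data.Vec.Base using ([]; _∷_; here; there; lookup; tabulate)
  open import Data.Vec.Properties using (≡-dec; lookup∘tabulate; tabulate∘lookup; tabulate-cong)
  open import Function.Base using (_∘_; id)
  open import Relation.Binary.Construct.Closure.Equivalence as Eq using ()
  open import Relation.Binary.PropositionalEquality
  open import Relation.Nullary using (Dec; yes; no; does; ¬_; ¬?)
  open import Relation.Nullary.Decidable using (does-⇔; dec-false; map′; _×-dec_)
  open import Function.Bundles using (mk⇔)
  open import Relation.Unary using (Decidable)
  open import Relation.Unary.Properties using (∁?; _∩?_)

  open import Algebra.Properties.CommutativeSemiring.Exp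
    (CommutativeRing.commutativeSemiring +-*-commutativeRing) using (^-homo-*; ^-distrib-*)
  open +-*-Solver using (solve; con; _:=_; _:+_; _:*_; _:-_)
  open ≡-Reasoning

  -- Natural numbers and decisions as rationals.

  infix 9 #_
  #_ : ℕ → ℚ
  # n = ℤ.+ n / 1

  -- `n / 1` is normalised through a gcd and does not reduce for variable `n`; among unnormalised
  -- rationals the sum is an identity of numerators.
  #-suc : ∀ n → # suc n ≡ 1ℚ + # n
  #-suc n = toℚᵘ-injective (ℚᵘ.≃-trans (toℚᵘ-fromℚᵘ (ℚᵘ.mkℚᵘ (ℤ.+ suc n) 0))
    (ℚᵘ.≃-sym (ℚᵘ.≃-trans (toℚᵘ-homo-+ 1ℚ (# n))
      (ℚᵘ.≃-trans (ℚᵘ.+-congʳ ℚᵘ.1ℚᵘ (toℚᵘ-fromℚᵘ (ℚᵘ.mkℚᵘ (ℤ.+ n) 0)))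
        (ℚᵘ.≃-reflexive (cong (λ i → ℚᵘ.mkℚᵘ i 0)
          (cong (ℤ._+_ (ℤ.+ 1)) (ℤ.*-identityʳ (ℤ.+ n)))))))))

  /-*-cancel : ∀ a b .{{_ : ℕ.NonZero b}} → (ℤ.+ a / b) * # b ≡ # a
  /-*-cancel a b@(suc b-1) = toℚᵘ-injective (ℚᵘ.≃-trans (toℚᵘ-homo-* (ℤ.+ a / b) (# b))
    (ℚᵘ.≃-trans (ℚᵘ.*-cong (toℚᵘ-fromℚᵘ (ℚᵘ.mkℚᵘ (ℤ.+ a) b-1)) (toℚᵘ-fromℚᵘ (ℚᵘ.mkℚᵘ (ℤ.+ b) 0)))
      (ℚᵘ.≃-trans (ℚᵘ.*≡* (trans (ℤ.*-identityʳ (ℤ.+ a ℤ.* ℤ.+ b)) (cong (λ i → ℤ.+ a ℤ.* ℤ.+ i) (sym (ℕ.*-identityʳ b)))))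
        (ℚᵘ.≃-sym (toℚᵘ-fromℚᵘ (ℚᵘ.mkℚᵘ (ℤ.+ a) 0))))))

  indicator : Bool → ℚ
  indicator b = if b then 1ℚ else 0ℚ

  -- Only the Boolean of a decision enters, so an indicator reduces wherever `does` reduces, for
  -- instance when vectors with different heads are compared.
  𝟙[_] : ∀ {p} {P : Set p} → Dec P → ℚ
  𝟙[ P? ] = indicator (does P?)

  𝟙-cong : ∀ {P Q : Set} (P? : Dec P) (Q? : Dec Q) → (P → Q) → (Q → P) → 𝟙[ P? ] ≡ 𝟙[ Q? ]
  𝟙-cong P? Q? f g = cong indicator (does-⇔ (mk⇔ f g) P? Q?)

  𝟙-no : ∀ {P : Set} (P? : Dec P) → ¬ P → 𝟙[ P? ] ≡ 0ℚ
  𝟙-no P? ¬p = cong indicator (dec-false P? ¬p)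

  -- Finite sums over lists.

  ∑ : ∀ {X : Set} → List X → (X → ℚ) → ℚ
  ∑ xs f = foldr _+_ 0ℚ (map f xs)

  private variable
    X Y : Set
    m n : ℕ

  ∑-cong : ∀ (xs : List X) {f g} → (∀ x → f x ≡ g x) → ∑ xs f ≡ ∑ xs g
  ∑-cong []       eq = refl
  ∑-cong (x ∷ xs) eq = cong₂ _+_ (eq x) (∑-cong xs eq)

  ∑-0 : ∀ (xs : List X) → ∑ xs (λ _ → 0ℚ) ≡ 0ℚ
  ∑-0 []       = refl
  ∑-0 (x ∷ xs) = trans (+-identityˡ _) (∑-0 xs)

  ∑-++ : ∀ (xs ys : List X) f → ∑ (xs ++ ys) f ≡ ∑ xs f + ∑ ys f
  ∑-++ []       ys f = sym (+-identityˡ _)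
  ∑-++ (x ∷ xs) ys f = trans (cong (f x +_) (∑-++ xs ys f)) (sym (+-assoc (f x) (∑ xs f) (∑ ys f)))

  ∑-map : ∀ (h : Y → X) ys f → ∑ (map h ys) f ≡ ∑ ys (f ∘ h)
  ∑-map h []       f = refl
  ∑-map h (y ∷ ys) f = cong (f (h y) +_) (∑-map h ys f)

  ∑-+ : ∀ (xs : List X) f g → ∑ xs (λ x → f x + g x) ≡ ∑ xs f + ∑ xs g
  ∑-+ []       f g = refl
  ∑-+ (x ∷ xs) f g = trans (cong (f x + g x +_) (∑-+ xs f g))
    (solve 4 (λ x y s t → (x :+ y) :+ (s :+ t) := (x :+ s) :+ (y :+ t)) refl (f x) (g x) (∑ xs f) (∑ xs g))

  ∑-*ˡ : ∀ a (xs : List X) f → ∑ xs (λ x → a * f x) ≡ a * ∑ xs f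
  ∑-*ˡ a []       f = sym (*-zeroʳ a)
  ∑-*ˡ a (x ∷ xs) f = trans (cong (a * f x +_) (∑-*ˡ a xs f)) (sym (*-distribˡ-+ a (f x) (∑ xs f)))

  ∑-swap : ∀ (xs : List X) (ys : List Y) (f : X → Y → ℚ) →
           ∑ xs (λ x → ∑ ys (λ y → f x y)) ≡ ∑ ys (λ y → ∑ xs (λ x → f x y))
  ∑-swap []       ys f = sym (∑-0 ys)
  ∑-swap (x ∷ xs) ys f = trans (cong (∑ ys (f x) +_) (∑-swap xs ys f)) (sym (∑-+ ys (f x) _))

  ∑-cartesianProduct : ∀ (xs : List X) (ys : List Y) f →
                       ∑ (cartesianProduct xs ys) f ≡ ∑ xs (λ x → ∑ ys (λ y → f (x , y)))
  ∑-cartesianProduct []       ys f = refl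
  ∑-cartesianProduct (x ∷ xs) ys f = trans
    (∑-++ (map (x ,_) ys) (cartesianProduct xs ys) f)
    (cong₂ _+_ (∑-map (x ,_) ys f) (∑-cartesianProduct xs ys f))

  #-length-filter : ∀ {P : X → Set} (P? : Decidable P) xs → # length (filter P? xs) ≡ ∑ xs (λ x → 𝟙[ P? x ])
  #-length-filter P? []       = refl
  #-length-filter P? (x ∷ xs) with does (P? x)
  ... | true  = trans (#-suc (length (filter P? xs))) (cong (1ℚ +_) (#-length-filter P? xs))
  ... | false = trans (#-length-filter P? xs) (sym (+-identityˡ _))

  #-length : ∀ (xs : List X) → # length xs ≡ ∑ xs (λ _ → 1ℚ)
  #-length []       = refl
  #-length (x ∷ xs) = trans (#-suc (length xs)) (cong (1ℚ +_) (#-length xs))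

  -- Sums over all subsets and product weights.

  ∑⊆-suc : (f : Subset (suc m) → ℚ) → ∑⊆ f ≡ ∑⊆ (f ∘ (outside ∷_)) + ∑⊆ (f ∘ (inside ∷_))
  ∑⊆-suc {m} f = trans (∑-++ (map (outside ∷_) (subsets m)) _ f)
    (cong₂ _+_ (∑-map (outside ∷_) (subsets m) f) (∑-map (inside ∷_) (subsets m) f))

  ∑⊆-cong : ∀ {f g : Subset m → ℚ} → (∀ A → f A ≡ g A) → ∑⊆ f ≡ ∑⊆ g
  ∑⊆-cong = ∑-cong (subsets _)

  ∑⊆-1 : ∀ m → ∑⊆ {m} (λ _ → 1ℚ) ≡ # 2 ^ m
  ∑⊆-1 zero    = refl
  ∑⊆-1 (suc m) = begin
    ∑⊆ {suc m} (λ _ → 1ℚ)                     ≡⟨ ∑⊆-suc {m} _ ⟩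
    ∑⊆ {m} (λ _ → 1ℚ) + ∑⊆ {m} (λ _ → 1ℚ)     ≡⟨ cong (λ x → x + x) (∑⊆-1 m) ⟩
    # 2 ^ m + # 2 ^ m                         ≡⟨ solve 1 (λ x → x :+ x := con (# 2) :* x) refl (# 2 ^ m) ⟩
    # 2 * # 2 ^ m                             ∎

  _≟ˢ_ : (S T : Subset n) → Dec (S ≡ T)
  _≟ˢ_ = ≡-dec Bool._≟_

  ∑⊆-δ : (T : Subset n) → ∑⊆ (λ S → 𝟙[ T ≟ˢ S ]) ≡ 1ℚ
  ∑⊆-δ []            = refl
  ∑⊆-δ {suc n} (outside ∷ T) = begin
    ∑⊆ (λ S → 𝟙[ (outside ∷ T) ≟ˢ S ])              ≡⟨ ∑⊆-suc {n} _ ⟩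
    ∑⊆ (λ S → 𝟙[ T ≟ˢ S ]) + ∑⊆ {n} (λ S → 0ℚ)      ≡⟨ cong₂ _+_ (∑⊆-δ T) (∑-0 (subsets n)) ⟩
    1ℚ                                             ∎
  ∑⊆-δ {suc n} (inside ∷ T) = begin
    ∑⊆ (λ S → 𝟙[ (inside ∷ T) ≟ˢ S ])               ≡⟨ ∑⊆-suc {n} _ ⟩
    ∑⊆ {n} (λ S → 0ℚ) + ∑⊆ (λ S → 𝟙[ T ≟ˢ S ])      ≡⟨ cong₂ _+_ (∑-0 (subsets n)) (∑⊆-δ T) ⟩
    1ℚ                                             ∎

  -- The monomial p^|A| q^(m - |A|), built edge by edge to follow the recursion of `subsets`.
  weight : ℚ → ℚ → Subset m → ℚ
  weight p q []            = 1ℚ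
  weight p q (inside  ∷ A) = p * weight p q A
  weight p q (outside ∷ A) = q * weight p q A

  weight-^ : ∀ p q (A : Subset m) → weight p q A ≡ p ^ ∣ A ∣ * q ^ ∣ ∁ A ∣
  weight-^ p q []            = refl
  weight-^ p q (inside  ∷ A) = trans (cong (p *_) (weight-^ p q A)) (sym (*-assoc p _ _))
  weight-^ p q (outside ∷ A) = trans (cong (q *_) (weight-^ p q A))
    (solve 3 (λ q x y → q :* (x :* y) := x :* (q :* y)) refl q (p ^ ∣ A ∣) (q ^ ∣ ∁ A ∣))

  -- The binomial theorem, read as the expansion of a product of m factors p + q.
  ∑⊆-weight : ∀ p q m → ∑⊆ (weight {m} p q) ≡ (p + q) ^ m
  ∑⊆-weight p q zero    = refl
  ∑⊆-weight p q (suc m) = begin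
    ∑⊆ (weight {suc m} p q)                                          ≡⟨ ∑⊆-suc {m} _ ⟩
    ∑⊆ (λ A → q * weight {m} p q A) + ∑⊆ (λ A → p * weight {m} p q A)
      ≡⟨ cong₂ _+_ (∑-*ˡ q (subsets m) _) (∑-*ˡ p (subsets m) _) ⟩
    q * ∑⊆ (weight {m} p q) + p * ∑⊆ (weight {m} p q)
      ≡⟨ solve 3 (λ p q x → q :* x :+ p :* x := (p :+ q) :* x) refl p q (∑⊆ (weight {m} p q)) ⟩
    (p + q) * ∑⊆ (weight {m} p q)                                    ≡⟨ cong ((p + q) *_) (∑⊆-weight p q m) ⟩
    (p + q) * (p + q) ^ m                                            ∎

  weight-1 : (A : Subset m) → weight 1ℚ 1ℚ A ≡ 1ℚ
  weight-1 []            = refl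
  weight-1 (inside  ∷ A) = trans (*-identityˡ _) (weight-1 A)
  weight-1 (outside ∷ A) = trans (*-identityˡ _) (weight-1 A)

  -- A set that omits an edge has a factor 0. This is the case q = p of the right side of
  -- `eulerian-enumerator`.
  ∑⊆-weight-⊤ : ∀ p (f : Subset m → ℚ) → ∑⊆ (λ A → weight p 0ℚ A * f A) ≡ p ^ m * f ⊤
  ∑⊆-weight-⊤ {zero}  p f = +-identityʳ _
  ∑⊆-weight-⊤ {suc m} p f = begin
    ∑⊆ (λ A → weight p 0ℚ A * f A)  ≡⟨ ∑⊆-suc {m} _ ⟩
    ∑⊆ (λ A → 0ℚ * weight p 0ℚ A * f (outside ∷ A)) + ∑⊆ (λ A → p * weight p 0ℚ A * f (inside ∷ A))
      ≡⟨ cong₂ _+_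
           (trans (∑⊆-cong {m} λ A → trans (cong (_* f (outside ∷ A)) (*-zeroˡ (weight p 0ℚ A))) (*-zeroˡ (f (outside ∷ A)))) (∑-0 (subsets m)))
           (∑⊆-cong {m} λ A → *-assoc p (weight p 0ℚ A) _) ⟩
    0ℚ + ∑⊆ (λ A → p * (weight p 0ℚ A * f (inside ∷ A)))  ≡⟨ +-identityˡ _ ⟩
    ∑⊆ (λ A → p * (weight p 0ℚ A * f (inside ∷ A)))       ≡⟨ ∑-*ˡ p (subsets m) _ ⟩
    p * ∑⊆ (λ A → weight p 0ℚ A * f (inside ∷ A))         ≡⟨ cong (p *_) (∑⊆-weight-⊤ p (f ∘ (inside ∷_))) ⟩
    p * (p ^ m * f ⊤)                                     ≡⟨ *-assoc p (p ^ m) (f ⊤) ⟨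
    p ^ suc m * f ⊤                                       ∎

  -- Sums over pairs through total size and symmetric difference.

  -- Leaving `f` arbitrary lets an induction on the edges absorb each chosen edge into a shift of
  -- `f`.
  ∑△ : (ℕ → ℚ) → (Subset m → ℚ) → ℚ
  ∑△ f g = ∑⊆ λ A → ∑⊆ λ B → f (∣ A ∣ ℕ.+ ∣ B ∣) * g (A △ B)

  -- The first edge lies in neither set, in B only, in A only, or in both. The total size grows by
  -- 0, 1, 1, 2, and the edge belongs to A △ B in the two middle cases.
  ∑△-suc : ∀ f (g : Subset (suc m) → ℚ) →
    ∑△ f g ≡ (∑△ f (g ∘ (outside ∷_)) + ∑△ (f ∘ ℕ.suc) (g ∘ (inside ∷_)))
           + (∑△ (f ∘ ℕ.suc) (g ∘ (inside ∷_)) + ∑△ (f ∘ ℕ.suc ∘ ℕ.suc) (g ∘ (outside ∷_)))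
  ∑△-suc {m} f g = begin
    ∑△ f g                                          ≡⟨ ∑⊆-suc {m} _ ⟩
    ∑⊆ (λ A → ∑⊆ (F outside A)) + ∑⊆ (λ A → ∑⊆ (F inside A))
      ≡⟨ cong₂ _+_ (split outside) (split inside) ⟩
    (∑△ f (g ∘ (outside ∷_)) + ∑⊆ (λ A → ∑⊆ (F outside A ∘ (inside ∷_))))
      + (∑△ (f ∘ ℕ.suc) (g ∘ (inside ∷_)) + ∑⊆ (λ A → ∑⊆ (F inside A ∘ (inside ∷_))))
      ≡⟨ cong₂ (λ x y → (∑△ f (g ∘ (outside ∷_)) + x) + (∑△ (f ∘ ℕ.suc) (g ∘ (inside ∷_)) + y))
           (∑⊆-cong {m} λ A → ∑⊆-cong {m} λ B → cong (λ i → f i * g (inside ∷ A △ B)) (ℕ.+-suc ∣ A ∣ ∣ B ∣))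
           (∑⊆-cong {m} λ A → ∑⊆-cong {m} λ B → cong (λ i → f (suc i) * g (outside ∷ A △ B)) (ℕ.+-suc ∣ A ∣ ∣ B ∣)) ⟩
    (∑△ f (g ∘ (outside ∷_)) + ∑△ (f ∘ ℕ.suc) (g ∘ (inside ∷_)))
      + (∑△ (f ∘ ℕ.suc) (g ∘ (inside ∷_)) + ∑△ (f ∘ ℕ.suc ∘ ℕ.suc) (g ∘ (outside ∷_))) ∎
    where
    F : Bool → Subset m → Subset (suc m) → ℚ
    F s A B = f (∣ s ∷ A ∣ ℕ.+ ∣ B ∣) * g ((s ∷ A) △ B)

    split : ∀ s → ∑⊆ (λ A → ∑⊆ (F s A)) ≡
                  ∑⊆ (λ A → ∑⊆ (F s A ∘ (outside ∷_))) + ∑⊆ (λ A → ∑⊆ (F s A ∘ (inside ∷_)))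
    split s = trans (∑⊆-cong {m} λ A → ∑⊆-suc (F s A)) (∑-+ (subsets m) _ _)

  ∑△-+ : ∀ f f′ (g : Subset m → ℚ) → ∑△ f g + ∑△ f′ g ≡ ∑△ (λ i → f i + f′ i) g
  ∑△-+ {m} f f′ g = sym (trans
    (∑⊆-cong {m} λ A → trans (∑⊆-cong {m} λ B → *-distribʳ-+ (g (A △ B)) (f _) (f′ _)) (∑-+ (subsets m) _ _))
    (∑-+ (subsets m) _ _))

  -- Each C is A △ B for exactly 2^m pairs, since A and C determine B. Hence A △ B is uniformly
  -- distributed.
  ∑△-1 : (g : Subset m → ℚ) → ∑△ (λ _ → 1ℚ) g ≡ # 2 ^ m * ∑⊆ g
  ∑△-1 {zero}  g = solve 1 (λ x → (con 1ℚ :* x :+ con 0ℚ) :+ con 0ℚ := con 1ℚ :* (x :+ con 0ℚ)) refl (g [])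
  ∑△-1 {suc m} g = begin
    ∑△ (λ _ → 1ℚ) g                          ≡⟨ ∑△-suc (λ _ → 1ℚ) g ⟩
    (∑△ (λ _ → 1ℚ) gₒ + ∑△ (λ _ → 1ℚ) gᵢ) + (∑△ (λ _ → 1ℚ) gᵢ + ∑△ (λ _ → 1ℚ) gₒ)
      ≡⟨ cong₂ (λ x y → (x + y) + (y + x)) (∑△-1 gₒ) (∑△-1 gᵢ) ⟩
    (t * ∑⊆ gₒ + t * ∑⊆ gᵢ) + (t * ∑⊆ gᵢ + t * ∑⊆ gₒ)
      ≡⟨ solve 3 (λ t x y → (t :* x :+ t :* y) :+ (t :* y :+ t :* x) := (con (# 2) :* t) :* (x :+ y)) refl
           t (∑⊆ gₒ) (∑⊆ gᵢ) ⟩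
    # 2 ^ suc m * (∑⊆ gₒ + ∑⊆ gᵢ)            ≡⟨ cong (# 2 ^ suc m *_) (∑⊆-suc g) ⟨
    # 2 ^ suc m * ∑⊆ g                       ∎
    where
    t = # 2 ^ m
    gₒ gᵢ : Subset m → ℚ
    gₒ = g ∘ (outside ∷_)
    gᵢ = g ∘ (inside ∷_)

  -- The hypothesis on f is 1 + ω + ω² = 0 without leaving ℚ.
  ∑△-filter : ∀ f → (∀ i → f i + f (1 ℕ.+ i) + f (2 ℕ.+ i) ≡ 0ℚ) → (g : Subset m → ℚ) →
              ∑△ f g ≡ f m * ∑⊆ (λ C → g C * weight (# 2) (- 1ℚ) C)
  ∑△-filter {zero}  f f-sum g = solve 2 (λ a x → (a :* x :+ con 0ℚ) :+ con 0ℚ := a :* (x :* con 1ℚ :+ con 0ℚ)) refl (f 0) (g [])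
  ∑△-filter {suc m} f f-sum g = begin
    ∑△ f g                                   ≡⟨ ∑△-suc f g ⟩
    (∑△ f gₒ + ∑△ (f ∘ ℕ.suc) gᵢ) + (∑△ (f ∘ ℕ.suc) gᵢ + ∑△ (f ∘ ℕ.suc ∘ ℕ.suc) gₒ)
      ≡⟨ solve 3 (λ x y z → (x :+ y) :+ (y :+ z) := (x :+ z) :+ con (# 2) :* y) refl
           (∑△ f gₒ) (∑△ (f ∘ ℕ.suc) gᵢ) (∑△ (f ∘ ℕ.suc ∘ ℕ.suc) gₒ) ⟩
    (∑△ f gₒ + ∑△ (f ∘ ℕ.suc ∘ ℕ.suc) gₒ) + # 2 * ∑△ (f ∘ ℕ.suc) gᵢ
      -- The two cases with the first edge outside C combine by f i + f (2 + i) = -f (1 + i). Now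
      -- every remaining term carries the same shift of `f`, with factor -1 or 2.
      ≡⟨ cong (_+ # 2 * ∑△ (f ∘ ℕ.suc) gᵢ) (trans (∑△-+ f (f ∘ ℕ.suc ∘ ℕ.suc) gₒ)
           (trans (∑⊆-cong {m} λ A → ∑⊆-cong {m} λ B → trans
               (cong (_* gₒ (A △ B)) (outer (∣ A ∣ ℕ.+ ∣ B ∣))) (*-assoc (- 1ℚ) (f _) (gₒ (A △ B))))
             (trans (∑⊆-cong {m} λ A → ∑-*ˡ (- 1ℚ) (subsets m) _) (∑-*ˡ (- 1ℚ) (subsets m) _)))) ⟩
    - 1ℚ * ∑△ (f ∘ ℕ.suc) gₒ + # 2 * ∑△ (f ∘ ℕ.suc) gᵢ
      ≡⟨ cong₂ (λ x y → - 1ℚ * x + # 2 * y) (∑△-filter (f ∘ ℕ.suc) (f-sum ∘ ℕ.suc) gₒ) (∑△-filter (f ∘ ℕ.suc) (f-sum ∘ ℕ.suc) gᵢ) ⟩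
    - 1ℚ * (f (suc m) * W gₒ) + # 2 * (f (suc m) * W gᵢ)
      ≡⟨ solve 3 (λ a x y → con (- 1ℚ) :* (a :* x) :+ con (# 2) :* (a :* y) := a :* (con (- 1ℚ) :* x :+ con (# 2) :* y)) refl
           (f (suc m)) (W gₒ) (W gᵢ) ⟩
    f (suc m) * (- 1ℚ * W gₒ + # 2 * W gᵢ)   ≡⟨ cong (f (suc m) *_) (cong₂ _+_ (pull (- 1ℚ) gₒ) (pull (# 2) gᵢ)) ⟩
    f (suc m) * (∑⊆ (λ C → gₒ C * (- 1ℚ * weight (# 2) (- 1ℚ) C)) + ∑⊆ (λ C → gᵢ C * (# 2 * weight (# 2) (- 1ℚ) C)))
      ≡⟨ cong (f (suc m) *_) (∑⊆-suc (λ C → g C * weight (# 2) (- 1ℚ) C)) ⟨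
    f (suc m) * ∑⊆ (λ C → g C * weight (# 2) (- 1ℚ) C) ∎
    where
    gₒ gᵢ : Subset m → ℚ
    gₒ = g ∘ (outside ∷_)
    gᵢ = g ∘ (inside ∷_)

    W : (Subset m → ℚ) → ℚ
    W h = ∑⊆ λ C → h C * weight (# 2) (- 1ℚ) C

    outer : ∀ i → f i + f (2 ℕ.+ i) ≡ - 1ℚ * f (1 ℕ.+ i)
    outer i = begin
      f i + f (2 ℕ.+ i)
        ≡⟨ solve 3 (λ x y z → x :+ z := (x :+ y :+ z) :+ con (- 1ℚ) :* y) refl (f i) (f (1 ℕ.+ i)) (f (2 ℕ.+ i)) ⟩
      (f i + f (1 ℕ.+ i) + f (2 ℕ.+ i)) + - 1ℚ * f (1 ℕ.+ i)  ≡⟨ cong (_+ - 1ℚ * f (1 ℕ.+ i)) (f-sum i) ⟩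
      0ℚ + - 1ℚ * f (1 ℕ.+ i)                                 ≡⟨ +-identityˡ _ ⟩
      - 1ℚ * f (1 ℕ.+ i)                                      ∎

    pull : ∀ c h → c * W h ≡ ∑⊆ λ C → h C * (c * weight (# 2) (- 1ℚ) C)
    pull c h = sym (trans
      (∑⊆-cong {m} λ C → solve 3 (λ c x y → x :* (c :* y) := c :* (x :* y)) refl c (h C) (weight (# 2) (- 1ℚ) C))
      (∑-*ˡ c (subsets m) _))

  -- Characters that detect even degrees.

  𝟙-× : ∀ {P Q : Set} (P? : Dec P) (Q? : Dec Q) → 𝟙[ P? ×-dec Q? ] ≡ 𝟙[ P? ] * 𝟙[ Q? ]
  𝟙-× P? Q? with does P?
  ... | true  = sym (*-identityˡ 𝟙[ Q? ])
  ... | false = sym (*-zeroˡ 𝟙[ Q? ])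

  -- The factor of a single vertex in `∑⊆-character`: the vertex lies outside S or in S. Both sides
  -- have period two in `i`.
  parity : ∀ i → 1ℚ + (- 1ℚ) ^ i ≡ # 2 * 𝟙[ 2 ∣? i ]
  parity 0             = refl
  parity 1             = refl
  parity (suc (suc i)) = begin
    1ℚ + - 1ℚ * (- 1ℚ * (- 1ℚ) ^ i)
      ≡⟨ solve 1 (λ x → con 1ℚ :+ con (- 1ℚ) :* (con (- 1ℚ) :* x) := con 1ℚ :+ x) refl ((- 1ℚ) ^ i) ⟩
    1ℚ + (- 1ℚ) ^ i                  ≡⟨ parity i ⟩
    # 2 * 𝟙[ 2 ∣? i ]                ≡⟨ cong (# 2 *_) (𝟙-cong (2 ∣? i) (2 ∣? suc (suc i))
                                          (∣m∣n⇒∣m+n ∣-refl) (λ 2∣2+i → ∣m+n∣m⇒∣n 2∣2+i ∣-refl)) ⟩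
    # 2 * 𝟙[ 2 ∣? suc (suc i) ]      ∎

  -- The product of (-1)^(d v) over v in S.
  character : Subset n → (Fin n → ℕ) → ℚ
  character []            d = 1ℚ
  character (outside ∷ S) d = character S (d ∘ Fin.suc)
  character (inside  ∷ S) d = (- 1ℚ) ^ d zero * character S (d ∘ Fin.suc)

  character-cong : ∀ (S : Subset n) {d d′} → (∀ v → d v ≡ d′ v) → character S d ≡ character S d′
  character-cong []            eq = refl
  character-cong (outside ∷ S) eq = character-cong S (eq ∘ Fin.suc)
  character-cong (inside  ∷ S) eq = cong₂ (λ i x → (- 1ℚ) ^ i * x) (eq zero) (character-cong S (eq ∘ Fin.suc))

  character-+ : ∀ (S : Subset n) d d′ → character S (λ v → d v ℕ.+ d′ v) ≡ character S d * character S d′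
  character-+ []            d d′ = refl
  character-+ (outside ∷ S) d d′ = character-+ S (d ∘ Fin.suc) (d′ ∘ Fin.suc)
  character-+ (inside  ∷ S) d d′ = trans
    (cong₂ _*_ (^-homo-* (- 1ℚ) (d zero) (d′ zero)) (character-+ S (d ∘ Fin.suc) (d′ ∘ Fin.suc)))
    (solve 4 (λ a b x y → (a :* b) :* (x :* y) := (a :* x) :* (b :* y)) refl
      ((- 1ℚ) ^ d zero) ((- 1ℚ) ^ d′ zero) (character S (d ∘ Fin.suc)) (character S (d′ ∘ Fin.suc)))

  character-0 : (S : Subset n) → character S (λ _ → 0) ≡ 1ℚ
  character-0 []            = refl
  character-0 (outside ∷ S) = character-0 S
  character-0 (inside  ∷ S) = trans (*-identityˡ _) (character-0 S)

  sign : Bool → ℚ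
  sign b = if b then - 1ℚ else 1ℚ

  bit : Bool → ℕ
  bit b = if b then 1 else 0

  character-δ : ∀ (S : Subset n) u → character S (λ v → bit (does (u ≟ v))) ≡ sign (lookup S u)
  character-δ (outside ∷ S) zero    = character-0 S
  character-δ (inside  ∷ S) zero    = cong (- 1ℚ *_) (character-0 S)
  character-δ (outside ∷ S) (suc u) = character-δ S u
  character-δ (inside  ∷ S) (suc u) = trans (*-identityˡ _) (character-δ S u)

  -- The sign of an edge is 1 if S does not separate its ends and -1 if it does. Making it linear in
  -- an indicator is what produces the weights 2p and q - p.
  sign-* : ∀ a b → sign a * sign b ≡ # 2 * 𝟙[ a Bool.≟ b ] - 1ℚ
  sign-* false false = refl
  sign-* false true  = refl
  sign-* true  false = refl
  sign-* true  true  = refl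

  -- The sum factors as the product of 1 + (-1)^(d v) over all vertices, which vanishes as soon as
  -- one d v is odd.
  ∑⊆-character : (d : Fin n → ℕ) → ∑⊆ (λ S → character S d) ≡ # 2 ^ n * 𝟙[ all? (λ v → 2 ∣? d v) ]
  ∑⊆-character {zero}  d = refl
  ∑⊆-character {suc n} d = begin
    ∑⊆ (λ S → character S d)                            ≡⟨ ∑⊆-suc {n} _ ⟩
    L + ∑⊆ (λ S → (- 1ℚ) ^ d zero * character S (d ∘ Fin.suc))
      ≡⟨ cong (L +_) (∑-*ˡ ((- 1ℚ) ^ d zero) (subsets n) _) ⟩
    L + (- 1ℚ) ^ d zero * L
      ≡⟨ solve 2 (λ x a → x :+ a :* x := (con 1ℚ :+ a) :* x) refl L ((- 1ℚ) ^ d zero) ⟩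
    (1ℚ + (- 1ℚ) ^ d zero) * L                          ≡⟨ cong₂ _*_ (parity (d zero)) (∑⊆-character (d ∘ Fin.suc)) ⟩
    (# 2 * 𝟙[ 2 ∣? d zero ]) * (# 2 ^ n * 𝟙[ all? (λ v → 2 ∣? d (suc v)) ])
      ≡⟨ solve 4 (λ a x b y → (a :* x) :* (b :* y) := (a :* b) :* (x :* y)) refl
           (# 2) 𝟙[ 2 ∣? d zero ] (# 2 ^ n) 𝟙[ all? (λ v → 2 ∣? d (suc v)) ] ⟩
    # 2 ^ suc n * (𝟙[ 2 ∣? d zero ] * 𝟙[ all? (λ v → 2 ∣? d (suc v)) ])
      ≡⟨ cong (# 2 ^ suc n *_) (trans (sym (𝟙-× (2 ∣? d zero) (all? (λ v → 2 ∣? d (suc v)))))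
           (𝟙-cong (2 ∣? d zero ×-dec all? (λ v → 2 ∣? d (suc v))) (all? (λ v → 2 ∣? d v))
             (λ where (p , ps) zero → p ; (p , ps) (suc v) → ps v) (λ ps → ps zero , ps ∘ Fin.suc))) ⟩
    # 2 ^ suc n * 𝟙[ all? (λ v → 2 ∣? d v) ]            ∎
    where L = ∑⊆ (λ S → character S (d ∘ Fin.suc))

  -- Removing an edge, and vertex sets that separate no edge.

  -- Exposes the end map, so that inductions can drop the first edge by passing to `η ∘ suc`.
  graph : (Fin m → Fin n × Fin n) → Graph
  graph {m} {n} η = record { #V = n ; #E = m ; ends = η }

  degree-inside : ∀ (η : Fin (suc m) → Fin n × Fin n) A v → degree (graph η) (inside ∷ A) v ≡
    (bit (does (proj₁ (η zero) ≟ v)) ℕ.+ bit (does (proj₂ (η zero) ≟ v))) ℕ.+ degree (graph (η ∘ Fin.suc)) A v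
  degree-inside η A v with does (proj₁ (η zero) ≟ v) | does (proj₂ (η zero) ≟ v)
  ... | false | false = refl
  ... | false | true  = ℕ.+-suc _ _
  ... | true  | false = refl
  ... | true  | true  = cong suc (ℕ.+-suc _ _)

  -- S separates no edge of A. Speaking of adjacent vertices only keeps this decidable edge by edge;
  -- connectivity enters in `∑⊆-respects`.
  Respects : (Fin m → Fin n × Fin n) → Subset n → Subset m → Set
  Respects η S A = ∀ {u v} → Adjacent η A u v → lookup S u ≡ lookup S v

  -- `map′` keeps the Boolean: the indicator at `outside ∷ A` is by computation that at `A`, and at
  -- `inside ∷ A` that of the conjunction. `∑⊆-weight-character` relies on both.
  respects? : ∀ (η : Fin m → Fin n × Fin n) S A → Dec (Respects η S A)
  respects? η S []            = yes λ where (() , _)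
  respects? η S (outside ∷ A) = map′
    (λ f → λ where (suc e , there e∈A , eq) → f (e , e∈A , eq))
    (λ f → λ where (e , e∈A , eq) → f (suc e , there e∈A , eq))
    (respects? (η ∘ Fin.suc) S A)
  respects? η S (inside ∷ A) = map′
    (λ (s≡t , f) → λ where (zero , here , refl) → s≡t ; (suc e , there e∈A , eq) → f (e , e∈A , eq))
    (λ f → f (zero , here , refl) , λ where (e , e∈A , eq) → f (suc e , there e∈A , eq))
    ((lookup S (proj₁ (η zero)) Bool.≟ lookup S (proj₂ (η zero))) ×-dec respects? (η ∘ Fin.suc) S A)

  -- A set that separates no edge of A is a union of components, hence the pullback along `class` of
  -- exactly one set of classes.
  ∑⊆-respects : ∀ (η : Fin m → Fin n × Fin n) A {k} → Classes (Connected η A) k →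
                ∑⊆ (λ S → 𝟙[ respects? η S A ]) ≡ # 2 ^ k
  ∑⊆-respects {n = n} η A {k} C = begin
    ∑⊆ (λ S → 𝟙[ respects? η S A ])                        ≡⟨ ∑⊆-cong {n} pullbacks ⟩
    ∑⊆ (λ S → ∑⊆ (λ T → 𝟙[ S ≟ˢ pullback T ]))             ≡⟨ ∑-swap (subsets n) (subsets k) _ ⟩
    ∑⊆ (λ T → ∑⊆ (λ S → 𝟙[ S ≟ˢ pullback T ]))
      ≡⟨ ∑⊆-cong {k} (λ T → trans (∑⊆-cong {n} λ S → 𝟙-cong (S ≟ˢ pullback T) (pullback T ≟ˢ S) sym sym) (∑⊆-δ (pullback T))) ⟩
    ∑⊆ {k} (λ T → 1ℚ)                                      ≡⟨ ∑⊆-1 k ⟩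
    # 2 ^ k                                                ∎
    where
    open Classes C

    pullback : Subset k → Subset n
    pullback T = tabulate (lookup T ∘ class)

    section : Fin k → Fin n
    section c = proj₁ (surjective c)

    class-section : ∀ c → class (section c) ≡ c
    class-section c = proj₂ (surjective c) refl

    -- Summing over all T, not just the fitting one, lets S be counted for fixed T.
    pullbacks : ∀ S → 𝟙[ respects? η S A ] ≡ ∑⊆ (λ T → 𝟙[ S ≟ˢ pullback T ])
    pullbacks S with respects? η S A
    ... | yes resp = sym (trans (∑⊆-cong {k} λ T → 𝟙-cong (S ≟ˢ pullback T) (restriction ≟ˢ T) (to T) (from T)) (∑⊆-δ restriction))
      where
      constant : ∀ {u v} → class u ≡ class v → lookup S u ≡ lookup S v
      constant = Eq.gfold isEquivalence (lookup S) resp ∘ complete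

      -- The only candidate for T: it is read off from S at one representative vertex of each class.
      restriction : Subset k
      restriction = tabulate (lookup S ∘ section)

      to : ∀ T → S ≡ pullback T → restriction ≡ T
      to T refl = trans (tabulate-cong λ c → trans (lookup∘tabulate (lookup T ∘ class) (section c))
        (cong (lookup T) (class-section c))) (tabulate∘lookup T)

      from : ∀ T → restriction ≡ T → S ≡ pullback T
      from T refl = trans (sym (tabulate∘lookup S)) (tabulate-cong λ v → sym (trans
        (lookup∘tabulate (lookup S ∘ section) (class v)) (constant (class-section (class v)))))
    ... | no ¬resp = sym (trans (∑⊆-cong {k} λ T → 𝟙-no (S ≟ˢ pullback T) (¬resp ∘ respects T)) (∑-0 (subsets k)))
      where
      respects : ∀ T → S ≡ pullback T → Respects η S A
      respects T refl {u} {v} uv = trans (lookup∘tabulate (lookup T ∘ class) u)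
        (trans (cong (lookup T) (sound (Eq.return uv))) (sym (lookup∘tabulate (lookup T ∘ class) v)))

  -- The weight enumerator of the eulerian sets.

  -- For fixed S both sides are the same product over the edges: if δ indicates that S does not
  -- separate the ends, an edge contributes q + p (2δ - 1) = (q - p) + 2pδ.
  ∑⊆-weight-character : ∀ p q (η : Fin m → Fin n × Fin n) S →
    ∑⊆ (λ C → weight p q C * character S (degree (graph η) C)) ≡
    ∑⊆ (λ A → weight (# 2 * p) (q - p) A * 𝟙[ respects? η S A ])
  ∑⊆-weight-character {zero}  p q η S = cong (λ x → 1ℚ * x + 0ℚ) (character-0 S)
  ∑⊆-weight-character {suc m} p q η S = begin
    ∑⊆ (λ C → weight p q C * χ η C)                    ≡⟨ ∑⊆-suc {m} _ ⟩
    -- An edge outside C leaves all degrees unchanged by computation, so only the second sum needs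
    -- `χ-inside`.
    ∑⊆ (λ C → q * w C * χ η′ C) + ∑⊆ (λ C → p * w C * χ η (inside ∷ C))
      ≡⟨ cong₂ _+_ (∑⊆-cong {m} λ C → *-assoc q (w C) (χ η′ C)) (∑⊆-cong {m} λ C → trans
           (cong (p * w C *_) (χ-inside C))
           (solve 4 (λ p w a x → (p :* w) :* (a :* x) := (p :* a) :* (w :* x)) refl p (w C) (# 2 * δ - 1ℚ) (χ η′ C))) ⟩
    ∑⊆ (λ C → q * (w C * χ η′ C)) + ∑⊆ (λ C → p * (# 2 * δ - 1ℚ) * (w C * χ η′ C))
      ≡⟨ cong₂ _+_ (∑-*ˡ q (subsets m) _) (∑-*ˡ (p * (# 2 * δ - 1ℚ)) (subsets m) _) ⟩
    q * L + p * (# 2 * δ - 1ℚ) * L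
      ≡⟨ solve 4 (λ p q a x → q :* x :+ (p :* (con (# 2) :* a :- con 1ℚ)) :* x
                            := (q :- p) :* x :+ ((con (# 2) :* p) :* a) :* x) refl p q δ L ⟩
    (q - p) * L + # 2 * p * δ * L
      ≡⟨ cong (λ x → (q - p) * x + # 2 * p * δ * x) (∑⊆-weight-character p q η′ S) ⟩
    (q - p) * R + # 2 * p * δ * R
      ≡⟨ cong₂ _+_ (∑-*ˡ (q - p) (subsets m) _) (∑-*ˡ (# 2 * p * δ) (subsets m) _) ⟨
    ∑⊆ (λ A → (q - p) * (w′ A * ρ A)) + ∑⊆ (λ A → # 2 * p * δ * (w′ A * ρ A))
      ≡⟨ cong₂ _+_ (∑⊆-cong {m} λ A → sym (*-assoc (q - p) (w′ A) (ρ A))) (∑⊆-cong {m} λ A → trans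
           (solve 4 (λ p a w x → (p :* a) :* (w :* x) := (p :* w) :* (a :* x)) refl (# 2 * p) δ (w′ A) (ρ A))
           (cong (# 2 * p * w′ A *_) (sym (𝟙-× (lookup S s Bool.≟ lookup S t) (respects? η′ S A))))) ⟩
    ∑⊆ (λ A → (q - p) * w′ A * ρ A) + ∑⊆ (λ A → # 2 * p * w′ A * 𝟙[ respects? η S (inside ∷ A) ])
      ≡⟨ ∑⊆-suc {m} (λ A → weight (# 2 * p) (q - p) A * 𝟙[ respects? η S A ]) ⟨
    ∑⊆ (λ A → weight (# 2 * p) (q - p) A * 𝟙[ respects? η S A ]) ∎
    where
    s = proj₁ (η zero)
    t = proj₂ (η zero)
    η′ = η ∘ Fin.suc
    δ = 𝟙[ lookup S s Bool.≟ lookup S t ]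

    χ : ∀ {m} → (Fin m → _) → Subset m → ℚ
    χ η C = character S (degree (graph η) C)

    w w′ ρ : Subset m → ℚ
    w    = weight p q
    w′   = weight (# 2 * p) (q - p)
    ρ A  = 𝟙[ respects? η′ S A ]

    L = ∑⊆ (λ C → w C * χ η′ C)
    R = ∑⊆ (λ A → w′ A * ρ A)

    χ-inside : ∀ C → χ η (inside ∷ C) ≡ (# 2 * δ - 1ℚ) * χ η′ C
    χ-inside C = begin
      χ η (inside ∷ C)             ≡⟨ character-cong S (degree-inside η C) ⟩
      character S (λ v → (bit (does (s ≟ v)) ℕ.+ bit (does (t ≟ v))) ℕ.+ degree (graph η′) C v)
        ≡⟨ character-+ S _ (degree (graph η′) C) ⟩
      character S (λ v → bit (does (s ≟ v)) ℕ.+ bit (does (t ≟ v))) * χ η′ C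
        ≡⟨ cong (_* χ η′ C) (trans (character-+ S _ _) (trans (cong₂ _*_ (character-δ S s) (character-δ S t))
             (sign-* (lookup S s) (lookup S t)))) ⟩
      (# 2 * δ - 1ℚ) * χ η′ C      ∎

  -- Two exchanges of summation: first over C and S to use the edge product for fixed S, then over S
  -- and A to count the S for fixed A. This is the two-state random cluster form of the even
  -- subgraph sum.
  eulerian-enumerator : ∀ p q G →
    # 2 ^ #V G * ∑⊆ (λ C → 𝟙[ eulerian? G C ] * weight p q C) ≡
    ∑⊆ (λ A → weight (# 2 * p) (q - p) A * # 2 ^ k G A)
  eulerian-enumerator p q G = begin
    # 2 ^ #V G * ∑⊆ (λ C → 𝟙[ eulerian? G C ] * weight p q C)
      ≡⟨ ∑-*ˡ (# 2 ^ #V G) Es _ ⟨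
    ∑⊆ (λ C → # 2 ^ #V G * (𝟙[ eulerian? G C ] * weight p q C))
      ≡⟨ ∑⊆-cong {#E G} (λ C → trans
           (solve 3 (λ a x w → a :* (x :* w) := w :* (a :* x)) refl (# 2 ^ #V G) 𝟙[ eulerian? G C ] (weight p q C))
           (trans (cong (weight p q C *_) (sym (∑⊆-character (degree G C)))) (sym (∑-*ˡ (weight p q C) Vs _)))) ⟩
    ∑⊆ (λ C → ∑⊆ (λ S → weight p q C * character S (degree G C)))
      ≡⟨ ∑-swap Es Vs _ ⟩
    ∑⊆ (λ S → ∑⊆ (λ C → weight p q C * character S (degree G C)))
      ≡⟨ ∑⊆-cong {#V G} (∑⊆-weight-character p q (ends G)) ⟩
    ∑⊆ (λ S → ∑⊆ (λ A → weight (# 2 * p) (q - p) A * 𝟙[ respects? (ends G) S A ]))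
      ≡⟨ ∑-swap Vs Es _ ⟩
    ∑⊆ (λ A → ∑⊆ (λ S → weight (# 2 * p) (q - p) A * 𝟙[ respects? (ends G) S A ]))
      ≡⟨ ∑⊆-cong {#E G} (λ A → trans (∑-*ˡ (weight (# 2 * p) (q - p) A) Vs _)
           (cong (weight (# 2 * p) (q - p) A *_) (∑⊆-respects (ends G) A (proj₂ (components (ends G) A))))) ⟩
    ∑⊆ (λ A → weight (# 2 * p) (q - p) A * # 2 ^ k G A) ∎
    where
    Es = subsets (#E G)
    Vs = subsets (#V G)

  -- Bounds on components and rank, which make the truncated subtractions exact.

  module _ {_~_ _≈_ : Fin n → Fin n → Set} {i j} (C : Classes _~_ i) (D : Classes _≈_ j) where

    -- Representatives of distinct classes of the coarser relation lie in distinct classes of the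
    -- finer one.
    classes-coarser : (∀ {u v} → u ~ v → u ≈ v) → j ℕ.≤ i
    classes-coarser ~⇒≈ = injective⇒≤ {f = C.class ∘ section} λ {c} {c′} eq →
      trans (sym (class-section c)) (trans (D.sound (~⇒≈ (C.complete eq))) (class-section c′))
      where
      module C = Classes C
      module D = Classes D

      section : Fin j → Fin n
      section c = proj₁ (D.surjective c)

      class-section : ∀ c → D.class (section c) ≡ c
      class-section c = proj₂ (D.surjective c) refl

  k-antitone : ∀ G A → k G ⊤ ℕ.≤ k G A
  k-antitone G A = classes-coarser (proj₂ (components (ends G) A)) (proj₂ (components (ends G) ⊤))
    (Eq.map λ (e , _ , eq) → e , ∈⊤ , eq)

  -- Equality of vertices has one class per vertex and is finer than connectivity.
  k≤#V : ∀ G A → k G A ℕ.≤ #V G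
  k≤#V G A = classes-coarser {_~_ = _≡_}
    (record { class = id ; surjective = λ v → v , id ; sound = id ; complete = id })
    (proj₂ (components (ends G) A)) λ where refl → Eq.reflexive (Adjacent (ends G) A)

  -- A new edge merges at most two classes. With no classes at all its end would have none to lie
  -- in.
  addEdge-≤ : ∀ (η : Fin (suc m) → Fin n × Fin n) A {i} (C : Classes (Connected (η ∘ Fin.suc) A) i) →
              i ℕ.≤ suc (proj₁ (addEdge η A C))
  addEdge-≤ η A C with Classes.class C (proj₁ (η zero)) ≟ Classes.class C (proj₂ (η zero))
  ... | yes _ = ℕ.n≤1+n _
  addEdge-≤ η A {zero}  C | no _ with () ← Classes.class C (proj₁ (η zero))
  addEdge-≤ η A {suc i} C | no _ = ℕ.≤-refl

  -- Starting from n isolated vertices, each edge of A lowers the number of components by at most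
  -- one.
  n≤∣A∣+components : ∀ (η : Fin m → Fin n × Fin n) A → n ℕ.≤ ∣ A ∣ ℕ.+ proj₁ (components η A)
  n≤∣A∣+components η []            = ℕ.≤-refl
  n≤∣A∣+components η (outside ∷ A) = n≤∣A∣+components (η ∘ Fin.suc) A
  n≤∣A∣+components η (inside  ∷ A) = ℕ.≤-trans (n≤∣A∣+components (η ∘ Fin.suc) A)
    (ℕ.≤-trans (ℕ.+-monoʳ-≤ ∣ A ∣ (addEdge-≤ η A (proj₂ (components (η ∘ Fin.suc) A))))
      (ℕ.≤-reflexive (ℕ.+-suc ∣ A ∣ _)))

  r≤∣A∣ : ∀ G A → r G A ℕ.≤ ∣ A ∣
  r≤∣A∣ G A = ℕ.≤-trans (ℕ.∸-monoˡ-≤ (k G A) (n≤∣A∣+components (ends G) A))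
    (ℕ.≤-reflexive (ℕ.m+n∸n≡m ∣ A ∣ (k G A)))

  r≤rank : ∀ G A → r G A ℕ.≤ rank G
  r≤rank G A = ℕ.∸-monoʳ-≤ (#V G) (k-antitone G A)

  -- The number of eulerian sets and the Tutte polynomial as evaluations of the enumerator.

  ½^*2^ : ∀ i → ½ ^ i * # 2 ^ i ≡ 1ℚ
  ½^*2^ zero    = refl
  ½^*2^ (suc i) = trans
    (solve 2 (λ x y → (con ½ :* x) :* (con (# 2) :* y) := x :* y) refl (½ ^ i) (# 2 ^ i)) (½^*2^ i)

  -- Identities are proved after scaling by powers of 2. The explicit inverse `½ ^ i` makes
  -- cancelling possible without nonzero instances.
  2^-cancel : ∀ i {x y} → # 2 ^ i * x ≡ # 2 ^ i * y → x ≡ y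
  2^-cancel i {x} {y} eq = trans (sym (undo x)) (trans (cong (½ ^ i *_) eq) (undo y))
    where
    undo : ∀ x → ½ ^ i * (# 2 ^ i * x) ≡ x
    undo x = trans (sym (*-assoc (½ ^ i) (# 2 ^ i) x)) (trans (cong (_* x) (½^*2^ i)) (*-identityˡ x))

  -- At p = q = 1 the weight q - p is 0, so only A = E survives on the right. The count is 2^n(G),
  -- the size of the cycle space over the field with two elements.
  eulerian-count : ∀ G → # 2 ^ rank G * ∑⊆ (λ C → 𝟙[ eulerian? G C ]) ≡ # 2 ^ #E G
  eulerian-count G = 2^-cancel (k G ⊤) (begin
    # 2 ^ k G ⊤ * (# 2 ^ rank G * ∑⊆ E)
      ≡⟨ trans (solve 3 (λ a b x → a :* (b :* x) := (b :* a) :* x) refl (# 2 ^ k G ⊤) (# 2 ^ rank G) (∑⊆ E))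
           (cong (_* ∑⊆ E) (trans (sym (^-homo-* (# 2) (rank G) (k G ⊤))) (cong (# 2 ^_) (ℕ.m∸n+n≡m (k≤#V G ⊤))))) ⟩
    # 2 ^ #V G * ∑⊆ E
      ≡⟨ cong (# 2 ^ #V G *_) (∑⊆-cong {#E G} λ C → trans (sym (*-identityʳ (E C))) (cong (E C *_) (sym (weight-1 C)))) ⟩
    # 2 ^ #V G * ∑⊆ (λ C → E C * weight 1ℚ 1ℚ C)      ≡⟨ eulerian-enumerator 1ℚ 1ℚ G ⟩
    ∑⊆ (λ A → weight (# 2) 0ℚ A * # 2 ^ k G A)        ≡⟨ ∑⊆-weight-⊤ (# 2) (λ A → # 2 ^ k G A) ⟩
    # 2 ^ #E G * # 2 ^ k G ⊤                          ≡⟨ *-comm (# 2 ^ #E G) (# 2 ^ k G ⊤) ⟩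
    # 2 ^ k G ⊤ * # 2 ^ #E G                          ∎)
    where
    E : Subset (#E G) → ℚ
    E C = 𝟙[ eulerian? G C ]

  -- Here ρ = r(A), κ = k(A), a = r(E) - r(A), b = |A| - r(A), z = |E| - |A| and ν = n(G). With
  -- these as independent variables no subtraction of exponents remains.
  tutte-exponents : ∀ ρ κ a b z ν → b ℕ.+ z ≡ a ℕ.+ ν →
    # 2 ^ (ρ ℕ.+ κ) * (# 4 ^ (ρ ℕ.+ a) * (- # 3) ^ ν * ((-½ - 1ℚ) ^ a * (- (ℤ.+ 1 / 3) - 1ℚ) ^ b)) ≡
    # 2 ^ (ρ ℕ.+ a) * (# 4 ^ (ρ ℕ.+ b) * (- # 3) ^ z * # 2 ^ κ)
  tutte-exponents ρ κ a b z ν b+z≡a+ν = begin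
    # 2 ^ (ρ ℕ.+ κ) * (# 4 ^ (ρ ℕ.+ a) * s ^ ν * (x ^ a * y ^ b))
      ≡⟨ cong₂ (λ u v → u * (v * s ^ ν * (x ^ a * y ^ b))) (^-homo-* (# 2) ρ κ) (^-homo-* (# 4) ρ a) ⟩
    # 2 ^ ρ * # 2 ^ κ * (# 4 ^ ρ * # 4 ^ a * s ^ ν * (x ^ a * y ^ b))
      ≡⟨ solve 7 (λ p q u v w t o → (p :* q) :* (((u :* v) :* w) :* (t :* o))
                                  := (((p :* q) :* u) :* (v :* t)) :* (w :* o)) refl
           (# 2 ^ ρ) (# 2 ^ κ) (# 4 ^ ρ) (# 4 ^ a) (s ^ ν) (x ^ a) (y ^ b) ⟩
    # 2 ^ ρ * # 2 ^ κ * # 4 ^ ρ * (# 4 ^ a * x ^ a) * (s ^ ν * y ^ b)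
      -- Both 4 (-3/2) and 2 (-3) compute to -6.
      ≡⟨ cong (λ u → # 2 ^ ρ * # 2 ^ κ * # 4 ^ ρ * u * (s ^ ν * y ^ b))
           (trans (sym (^-distrib-* (# 4) x a)) (^-distrib-* (# 2) s a)) ⟩
    # 2 ^ ρ * # 2 ^ κ * # 4 ^ ρ * (# 2 ^ a * s ^ a) * (s ^ ν * y ^ b)
      ≡⟨ solve 7 (λ p q u v w t o → (((p :* q) :* u) :* (v :* w)) :* (t :* o)
                                  := (((p :* q) :* u) :* v) :* ((w :* t) :* o)) refl
           (# 2 ^ ρ) (# 2 ^ κ) (# 4 ^ ρ) (# 2 ^ a) (s ^ a) (s ^ ν) (y ^ b) ⟩
    # 2 ^ ρ * # 2 ^ κ * # 4 ^ ρ * # 2 ^ a * (s ^ a * s ^ ν * y ^ b)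
      ≡⟨ cong (λ u → # 2 ^ ρ * # 2 ^ κ * # 4 ^ ρ * # 2 ^ a * (u * y ^ b))
           (trans (sym (^-homo-* s a ν)) (trans (cong (s ^_) (sym b+z≡a+ν)) (^-homo-* s b z))) ⟩
    # 2 ^ ρ * # 2 ^ κ * # 4 ^ ρ * # 2 ^ a * (s ^ b * s ^ z * y ^ b)
      ≡⟨ solve 7 (λ p q u v w t o → (((p :* q) :* u) :* v) :* ((w :* t) :* o)
                                  := (p :* v) :* (((u :* (w :* o)) :* t) :* q)) refl
           (# 2 ^ ρ) (# 2 ^ κ) (# 4 ^ ρ) (# 2 ^ a) (s ^ b) (s ^ z) (y ^ b) ⟩
    # 2 ^ ρ * # 2 ^ a * (# 4 ^ ρ * (s ^ b * y ^ b) * s ^ z * # 2 ^ κ)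
      -- The product (-3) (-4/3) computes to 4.
      ≡⟨ cong (λ u → # 2 ^ ρ * # 2 ^ a * (# 4 ^ ρ * u * s ^ z * # 2 ^ κ)) (^-distrib-* s y b) ⟨
    # 2 ^ ρ * # 2 ^ a * (# 4 ^ ρ * # 4 ^ b * s ^ z * # 2 ^ κ)
      ≡⟨ cong₂ (λ u v → u * (v * s ^ z * # 2 ^ κ)) (^-homo-* (# 2) ρ a) (^-homo-* (# 4) ρ b) ⟨
    # 2 ^ (ρ ℕ.+ a) * (# 4 ^ (ρ ℕ.+ b) * s ^ z * # 2 ^ κ) ∎
    where
    s = - # 3
    x = -½ - 1ℚ
    y = - (ℤ.+ 1 / 3) - 1ℚ

  -- The Tutte summand of A matches the summand of A in `eulerian-enumerator` at p = 2, q = -1,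
  -- where 2p = 4 and q - p = -3.
  tutte-term : ∀ G A →
    # 2 ^ #V G * (# 4 ^ rank G * (- # 3) ^ nullity G *
      ((-½ - 1ℚ) ^ (rank G ∸ r G A) * (- (ℤ.+ 1 / 3) - 1ℚ) ^ (∣ A ∣ ∸ r G A))) ≡
    # 2 ^ rank G * (weight (# 4) (- # 3) A * # 2 ^ k G A)
  tutte-term G A = begin
    # 2 ^ #V G * (# 4 ^ rank G * (- # 3) ^ nullity G * t)
      ≡⟨ cong₂ (λ i j → # 2 ^ i * (# 4 ^ j * (- # 3) ^ nullity G * t)) #V≡ρ+κ rank≡ρ+a ⟩
    # 2 ^ (ρ ℕ.+ κ) * (# 4 ^ (ρ ℕ.+ a) * (- # 3) ^ nullity G * t)
      ≡⟨ tutte-exponents ρ κ a b z (nullity G) exponents ⟩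
    # 2 ^ (ρ ℕ.+ a) * (# 4 ^ (ρ ℕ.+ b) * (- # 3) ^ z * # 2 ^ κ)
      ≡⟨ cong₂ (λ i j → # 2 ^ i * (# 4 ^ j * (- # 3) ^ z * # 2 ^ κ)) rank≡ρ+a ∣A∣≡ρ+b ⟨
    # 2 ^ rank G * (# 4 ^ ∣ A ∣ * (- # 3) ^ z * # 2 ^ κ)
      ≡⟨ cong (λ w → # 2 ^ rank G * (w * # 2 ^ κ)) (weight-^ (# 4) (- # 3) A) ⟨
    # 2 ^ rank G * (weight (# 4) (- # 3) A * # 2 ^ κ) ∎
    where
    ρ = r G A
    κ = k G A
    a = rank G ∸ ρ
    b = ∣ A ∣ ∸ ρ
    z = ∣ ∁ A ∣
    t = (-½ - 1ℚ) ^ a * (- (ℤ.+ 1 / 3) - 1ℚ) ^ b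

    #V≡ρ+κ : #V G ≡ ρ ℕ.+ κ
    #V≡ρ+κ = sym (ℕ.m∸n+n≡m (k≤#V G A))

    rank≡ρ+a : rank G ≡ ρ ℕ.+ a
    rank≡ρ+a = sym (ℕ.m+[n∸m]≡n (r≤rank G A))

    ∣A∣≡ρ+b : ∣ A ∣ ≡ ρ ℕ.+ b
    ∣A∣≡ρ+b = sym (ℕ.m+[n∸m]≡n (r≤∣A∣ G A))

    -- After adding ρ both sides count all edges: |A| plus its complement, and rank plus nullity.
    exponents : b ℕ.+ z ≡ a ℕ.+ nullity G
    exponents = ℕ.+-cancelˡ-≡ ρ _ _ (begin
      ρ ℕ.+ (b ℕ.+ z)                ≡⟨ ℕ.+-assoc ρ b z ⟨
      ρ ℕ.+ b ℕ.+ z                  ≡⟨ cong₂ ℕ._+_ (sym ∣A∣≡ρ+b) (∣∁p∣≡n∸∣p∣ A) ⟩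
      ∣ A ∣ ℕ.+ (#E G ∸ ∣ A ∣)       ≡⟨ ℕ.m+[n∸m]≡n (∣p∣≤n A) ⟩
      #E G                           ≡⟨ ℕ.m+[n∸m]≡n (ℕ.≤-trans (r≤∣A∣ G ⊤) (∣p∣≤n {#E G} ⊤)) ⟨
      rank G ℕ.+ nullity G           ≡⟨ cong (ℕ._+ nullity G) rank≡ρ+a ⟩
      ρ ℕ.+ a ℕ.+ nullity G          ≡⟨ ℕ.+-assoc ρ a (nullity G) ⟩
      ρ ℕ.+ (a ℕ.+ nullity G)        ∎)

  signedEulerianSum : Graph → ℚ
  signedEulerianSum G = ∑⊆ λ C → 𝟙[ eulerian? G C ] * weight (# 2) (- 1ℚ) C

  tutte-eulerian : ∀ G → # 4 ^ rank G * (- # 3) ^ nullity G * Tutte G -½ (- (ℤ.+ 1 / 3)) ≡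
                         # 2 ^ rank G * signedEulerianSum G
  tutte-eulerian G = 2^-cancel (#V G) (begin
    # 2 ^ #V G * (c * ∑⊆ t)                          ≡⟨ cong (# 2 ^ #V G *_) (∑-*ˡ c Es t) ⟨
    # 2 ^ #V G * ∑⊆ (λ A → c * t A)                  ≡⟨ ∑-*ˡ (# 2 ^ #V G) Es (λ A → c * t A) ⟨
    ∑⊆ (λ A → # 2 ^ #V G * (c * t A))                ≡⟨ ∑⊆-cong {#E G} (tutte-term G) ⟩
    ∑⊆ (λ A → # 2 ^ rank G * (weight (# 4) (- # 3) A * # 2 ^ k G A))
      ≡⟨ ∑-*ˡ (# 2 ^ rank G) Es _ ⟩
    # 2 ^ rank G * ∑⊆ (λ A → weight (# 4) (- # 3) A * # 2 ^ k G A)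
      ≡⟨ cong (# 2 ^ rank G *_) (eulerian-enumerator (# 2) (- 1ℚ) G) ⟨
    # 2 ^ rank G * (# 2 ^ #V G * signedEulerianSum G)
      ≡⟨ solve 3 (λ x y z → x :* (y :* z) := y :* (x :* z)) refl (# 2 ^ rank G) (# 2 ^ #V G) (signedEulerianSum G) ⟩
    # 2 ^ #V G * (# 2 ^ rank G * signedEulerianSum G) ∎)
    where
    Es = subsets (#E G)
    c = # 4 ^ rank G * (- # 3) ^ nullity G

    t : Subset (#E G) → ℚ
    t A = (-½ - 1ℚ) ^ (rank G ∸ r G A) * (- (ℤ.+ 1 / 3) - 1ℚ) ^ (∣ A ∣ ∸ r G A)

  -- Probabilities and biases as sums over pairs.

  #-length-pairs : ∀ m → # length (pairs m) ≡ # 2 ^ m * # 2 ^ m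
  #-length-pairs m = begin
    # length (pairs m)                        ≡⟨ #-length (pairs m) ⟩
    ∑ (pairs m) (λ _ → 1ℚ)                    ≡⟨ ∑-cartesianProduct (subsets m) (subsets m) (λ _ → 1ℚ) ⟩
    -- Since 1 * 1 computes to 1, this is `∑△` for two constant functions.
    ∑⊆ {m} (λ _ → ∑⊆ {m} (λ _ → 1ℚ))          ≡⟨ ∑△-1 {m} (λ _ → 1ℚ) ⟩
    # 2 ^ m * ∑⊆ {m} (λ _ → 1ℚ)               ≡⟨ cong (# 2 ^ m *_) (∑⊆-1 m) ⟩
    # 2 ^ m * # 2 ^ m                         ∎

  ℙ-∑ : ∀ {P} (S : Event m P) → # 2 ^ m * # 2 ^ m * ℙ[ S ] ≡ ∑⊆ λ A → ∑⊆ λ B → 𝟙[ S (A , B) ]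
  ℙ-∑ {m} S = begin
    # 2 ^ m * # 2 ^ m * ℙ[ S ]                ≡⟨ cong (_* ℙ[ S ]) (#-length-pairs m) ⟨
    # length (pairs m) * ℙ[ S ]               ≡⟨ *-comm (# length (pairs m)) ℙ[ S ] ⟩
    ℙ[ S ] * # length (pairs m)
      ≡⟨ /-*-cancel (length (filter S (pairs m))) (length (pairs m)) {{pairs-nonZero m}} ⟩
    # length (filter S (pairs m))             ≡⟨ #-length-filter S (pairs m) ⟩
    ∑ (pairs m) (λ ω → 𝟙[ S ω ])              ≡⟨ ∑-cartesianProduct (subsets m) (subsets m) (λ ω → 𝟙[ S ω ]) ⟩
    ∑⊆ (λ A → ∑⊆ λ B → 𝟙[ S (A , B) ])        ∎

  -- A △ B is uniform by `∑△-1`, so P(Δ) is the proportion of eulerian sets among all edge sets.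
  ℙΔ : ∀ G → # 2 ^ rank G * ℙ[ Δ G ] ≡ 1ℚ
  ℙΔ G = 2^-cancel (#E G) (begin
    p * (# 2 ^ rank G * ℙ[ Δ G ])
      ≡⟨ solve 3 (λ x y z → x :* (y :* z) := y :* (x :* z)) refl p (# 2 ^ rank G) ℙ[ Δ G ] ⟩
    # 2 ^ rank G * (p * ℙ[ Δ G ])             ≡⟨ cong (# 2 ^ rank G *_) (2^-cancel (#E G) scaled) ⟩
    # 2 ^ rank G * ∑⊆ E                       ≡⟨ eulerian-count G ⟩
    p                                         ≡⟨ *-identityʳ p ⟨
    p * 1ℚ                                    ∎)
    where
    p = # 2 ^ #E G

    E : Subset (#E G) → ℚ
    E C = 𝟙[ eulerian? G C ]

    scaled : p * (p * ℙ[ Δ G ]) ≡ p * ∑⊆ E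
    scaled = begin
      p * (p * ℙ[ Δ G ])                      ≡⟨ *-assoc p p ℙ[ Δ G ] ⟨
      p * p * ℙ[ Δ G ]                        ≡⟨ ℙ-∑ (Δ G) ⟩
      ∑⊆ (λ A → ∑⊆ λ B → E (A △ B))
        ≡⟨ ∑⊆-cong {#E G} (λ A → ∑⊆-cong {#E G} λ B → sym (*-identityˡ (E (A △ B)))) ⟩
      ∑△ (λ _ → 1ℚ) E                         ≡⟨ ∑△-1 E ⟩
      p * ∑⊆ E                                ∎

  -- The expectation of σ c at |A| + |B| is the bias of the event total≡ c.
  σ : ℕ → ℕ → ℚ
  σ c i = 𝟙[ i % 3 ℕ.≟ c % 3 ] - 𝟙[ ¬? (i % 3 ℕ.≟ c % 3) ]

  -- Of three consecutive numbers exactly one is congruent to c, giving one value 1 and two values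
  -- -1. Both arguments have period three, which leaves nine computations.
  σ-sum : ∀ c i → σ c i + σ c (1 ℕ.+ i) + σ c (2 ℕ.+ i) ≡ - 1ℚ
  σ-sum 0 0 = refl
  σ-sum 0 1 = refl
  σ-sum 0 2 = refl
  σ-sum 1 0 = refl
  σ-sum 1 1 = refl
  σ-sum 1 2 = refl
  σ-sum 2 0 = refl
  σ-sum 2 1 = refl
  σ-sum 2 2 = refl
  σ-sum (suc (suc (suc c))) i = σ-sum c i
  σ-sum 0 (suc (suc (suc i))) = σ-sum 0 i
  σ-sum 1 (suc (suc (suc i))) = σ-sum 1 i
  σ-sum 2 (suc (suc (suc i))) = σ-sum 2 i

  -- The filter evaluates `σ` at |E| only. This value and the next two belong to the residues |E|,
  -- |E| + 1 and |E| + 2; that the last two agree is the source of the first claim.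
  σ-≡ : ∀ i → σ i i ≡ 1ℚ
  σ-≡ 0 = refl
  σ-≡ 1 = refl
  σ-≡ 2 = refl
  σ-≡ (suc (suc (suc i))) = σ-≡ i

  σ-+1 : ∀ i → σ (i ℕ.+ 1) i ≡ - 1ℚ
  σ-+1 0 = refl
  σ-+1 1 = refl
  σ-+1 2 = refl
  σ-+1 (suc (suc (suc i))) = σ-+1 i

  σ-+2 : ∀ i → σ (i ℕ.+ 2) i ≡ - 1ℚ
  σ-+2 0 = refl
  σ-+2 1 = refl
  σ-+2 2 = refl
  σ-+2 (suc (suc (suc i))) = σ-+2 i

  ∑-− : ∀ (xs : List X) f g → ∑ xs (λ x → f x - g x) ≡ ∑ xs f - ∑ xs g
  ∑-− []       f g = refl
  ∑-− (x ∷ xs) f g = trans (cong (f x - g x +_) (∑-− xs f g))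
    (solve 4 (λ x y s t → (x :- y) :+ (s :- t) := (x :+ s) :- (y :+ t)) refl (f x) (g x) (∑ xs f) (∑ xs g))

  ∑∑-− : ∀ (F H : Subset m → Subset m → ℚ) →
    ∑⊆ (λ A → ∑⊆ (F A)) - ∑⊆ (λ A → ∑⊆ (H A)) ≡ ∑⊆ (λ A → ∑⊆ (λ B → F A B - H A B))
  ∑∑-− {m} F H = sym (trans (∑⊆-cong {m} λ A → ∑-− (subsets m) (F A) (H A)) (∑-− (subsets m) _ _))

  -- Differences of biases for a fixed graph.

  module _ (G : Graph) where

    private
      instance
        ℙΔ≢0 = Δ-nonZero G
      p = # 2 ^ #E G

      E : Subset (#E G) → ℚ
      E C = 𝟙[ eulerian? G C ]

      one : Subset (#E G) → ℚ
      one _ = 1ℚ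

    bias-∑△ : ∀ c → p * p * Bias[ total≡ G c ] ≡ ∑△ (σ c) one
    bias-∑△ c = begin
      p * p * (ℙ[ S ] - ℙ[ ∁? S ])
        ≡⟨ solve 3 (λ p x y → p :* (x :- y) := p :* x :- p :* y) refl (p * p) ℙ[ S ] ℙ[ ∁? S ] ⟩
      p * p * ℙ[ S ] - p * p * ℙ[ ∁? S ]       ≡⟨ cong₂ _-_ (ℙ-∑ S) (ℙ-∑ (∁? S)) ⟩
      ∑⊆ (λ A → ∑⊆ λ B → 𝟙[ S (A , B) ]) - ∑⊆ (λ A → ∑⊆ λ B → 𝟙[ ∁? S (A , B) ])
        ≡⟨ ∑∑-− {#E G} (λ A B → 𝟙[ S (A , B) ]) (λ A B → 𝟙[ ∁? S (A , B) ]) ⟩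
      ∑⊆ (λ A → ∑⊆ λ B → 𝟙[ S (A , B) ] - 𝟙[ ∁? S (A , B) ])
        ≡⟨ ∑⊆-cong {#E G} (λ A → ∑⊆-cong {#E G} λ B → sym (*-identityʳ (σ c (∣ A ∣ ℕ.+ ∣ B ∣)))) ⟩
      ∑△ (σ c) one                             ∎
      where S = total≡ G c

    -- The factor P(Δ) cancels the denominator of the conditional probabilities; conditioning then
    -- only replaces the constant 1 by the indicator of eulerian sets.
    bias∣Δ-∑△ : ∀ c → p * p * (ℙ[ Δ G ] * Bias[ total≡ G c ∣ Δ G ]) ≡ ∑△ (σ c) E
    bias∣Δ-∑△ c = begin
      p * p * (ℙ[ Δ G ] * (ℙ[ S ∩? Δ G ] * 1/ ℙ[ Δ G ] - ℙ[ ∁? S ∩? Δ G ] * 1/ ℙ[ Δ G ]))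
        ≡⟨ solve 5 (λ p d i x y → p :* (d :* (x :* i :- y :* i)) := (i :* d) :* (p :* x :- p :* y)) refl
             (p * p) ℙ[ Δ G ] (1/ ℙ[ Δ G ]) ℙ[ S ∩? Δ G ] ℙ[ ∁? S ∩? Δ G ] ⟩
      1/ ℙ[ Δ G ] * ℙ[ Δ G ] * (p * p * ℙ[ S ∩? Δ G ] - p * p * ℙ[ ∁? S ∩? Δ G ])
        ≡⟨ cong₂ _*_ (*-inverseˡ ℙ[ Δ G ]) (cong₂ _-_ (ℙ-∑ (S ∩? Δ G)) (ℙ-∑ (∁? S ∩? Δ G))) ⟩
      1ℚ * (∑⊆ (λ A → ∑⊆ λ B → 𝟙[ (S ∩? Δ G) (A , B) ]) - ∑⊆ (λ A → ∑⊆ λ B → 𝟙[ (∁? S ∩? Δ G) (A , B) ]))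
        ≡⟨ *-identityˡ _ ⟩
      ∑⊆ (λ A → ∑⊆ λ B → 𝟙[ (S ∩? Δ G) (A , B) ]) - ∑⊆ (λ A → ∑⊆ λ B → 𝟙[ (∁? S ∩? Δ G) (A , B) ])
        ≡⟨ ∑∑-− {#E G} (λ A B → 𝟙[ (S ∩? Δ G) (A , B) ]) (λ A B → 𝟙[ (∁? S ∩? Δ G) (A , B) ]) ⟩
      ∑⊆ (λ A → ∑⊆ λ B → 𝟙[ (S ∩? Δ G) (A , B) ] - 𝟙[ (∁? S ∩? Δ G) (A , B) ])
        ≡⟨ ∑⊆-cong {#E G} (λ A → ∑⊆-cong {#E G} λ B → trans
             (cong₂ _-_ (𝟙-× (S (A , B)) (Δ G (A , B))) (𝟙-× (∁? S (A , B)) (Δ G (A , B))))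
             (solve 3 (λ x y e → x :* e :- y :* e := (x :- y) :* e) refl 𝟙[ S (A , B) ] 𝟙[ ∁? S (A , B) ] (E (A △ B)))) ⟩
      ∑△ (σ c) E                               ∎
      where S = total≡ G c

    -- A single `σ c` sums to -1 over a period, so `∑△-filter` applies only to the difference of
    -- two, which sums to 0.
    σ-gap : ∀ c c′ (g : Subset (#E G) → ℚ) →
      ∑△ (σ c) g - ∑△ (σ c′) g ≡ (σ c (#E G) - σ c′ (#E G)) * ∑⊆ (λ C → g C * weight (# 2) (- 1ℚ) C)
    σ-gap c c′ g = trans (∑∑-− {#E G} (λ A B → σ c (∣ A ∣ ℕ.+ ∣ B ∣) * g (A △ B)) (λ A B → σ c′ (∣ A ∣ ℕ.+ ∣ B ∣) * g (A △ B)))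
      (trans (∑⊆-cong {#E G} λ A → ∑⊆-cong {#E G} λ B →
          solve 3 (λ x y z → x :* z :- y :* z := (x :- y) :* z) refl
            (σ c (∣ A ∣ ℕ.+ ∣ B ∣)) (σ c′ (∣ A ∣ ℕ.+ ∣ B ∣)) (g (A △ B)))
        (∑△-filter (λ i → σ c i - σ c′ i) sum-zero g))
      where
      sum-zero : ∀ i → (σ c i - σ c′ i) + (σ c (1 ℕ.+ i) - σ c′ (1 ℕ.+ i)) + (σ c (2 ℕ.+ i) - σ c′ (2 ℕ.+ i)) ≡ 0ℚ
      sum-zero i = trans
        (solve 6 (λ a b c x y z → (a :- x) :+ (b :- y) :+ (c :- z) := (a :+ b :+ c) :- (x :+ y :+ z)) refl
          (σ c i) (σ c (1 ℕ.+ i)) (σ c (2 ℕ.+ i)) (σ c′ i) (σ c′ (1 ℕ.+ i)) (σ c′ (2 ℕ.+ i)))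
        (cong₂ _-_ (σ-sum c i) (σ-sum c′ i))

    -- Without conditioning the weights sum to (2 - 1)^|E| = 1, and the values of `σ` differ by 1 -
    -- (-1) = 2.
    bias-gap : p * p * (Bias[ total≡ G (#E G) ] - Bias[ total≡ G (#E G ℕ.+ 1) ]) ≡ # 2
    bias-gap = begin
      p * p * (b₀ - b₁)
        ≡⟨ solve 3 (λ p x y → p :* (x :- y) := p :* x :- p :* y) refl (p * p) b₀ b₁ ⟩
      p * p * b₀ - p * p * b₁                  ≡⟨ cong₂ _-_ (bias-∑△ μ) (bias-∑△ (μ ℕ.+ 1)) ⟩
      ∑△ (σ μ) one - ∑△ (σ (μ ℕ.+ 1)) one      ≡⟨ σ-gap μ (μ ℕ.+ 1) one ⟩
      (σ μ μ - σ (μ ℕ.+ 1) μ) * ∑⊆ (λ C → one C * weight (# 2) (- 1ℚ) C)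
        ≡⟨ cong₂ _*_ (cong₂ _-_ (σ-≡ μ) (σ-+1 μ)) (trans (∑⊆-cong {#E G} λ C → *-identityˡ (weight (# 2) (- 1ℚ) C))
             (∑⊆-weight (# 2) (- 1ℚ) μ)) ⟩
      # 2 * 1ℚ ^ μ                             ≡⟨ cong (# 2 *_) (1^ μ) ⟩
      # 2                                      ∎
      where
      μ  = #E G
      b₀ = Bias[ total≡ G μ ]
      b₁ = Bias[ total≡ G (μ ℕ.+ 1) ]

      1^ : ∀ i → 1ℚ ^ i ≡ 1ℚ
      1^ zero    = refl
      1^ (suc i) = trans (*-identityˡ _) (1^ i)

    -- Division by P(Δ) becomes multiplication by 2^r(G), since `ℙΔ` lets their product be inserted
    -- as 1.
    bias∣Δ-gap : ∀ c c′ → p * p * (Bias[ total≡ G c ∣ Δ G ] - Bias[ total≡ G c′ ∣ Δ G ]) ≡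
                 # 2 ^ rank G * ((σ c (#E G) - σ c′ (#E G)) * signedEulerianSum G)
    bias∣Δ-gap c c′ = begin
      p * p * (b - b′)                         ≡⟨ *-identityˡ _ ⟨
      1ℚ * (p * p * (b - b′))                  ≡⟨ cong (_* (p * p * (b - b′))) (ℙΔ G) ⟨
      # 2 ^ rank G * ℙ[ Δ G ] * (p * p * (b - b′))
        ≡⟨ solve 5 (λ t d p x y → (t :* d) :* (p :* (x :- y)) := t :* (p :* (d :* x) :- p :* (d :* y))) refl
             (# 2 ^ rank G) ℙ[ Δ G ] (p * p) b b′ ⟩
      # 2 ^ rank G * (p * p * (ℙ[ Δ G ] * b) - p * p * (ℙ[ Δ G ] * b′))
        ≡⟨ cong (# 2 ^ rank G *_) (trans (cong₂ _-_ (bias∣Δ-∑△ c) (bias∣Δ-∑△ c′)) (σ-gap c c′ E)) ⟩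
      # 2 ^ rank G * ((σ c (#E G) - σ c′ (#E G)) * signedEulerianSum G) ∎
      where
      b  = Bias[ total≡ G c ∣ Δ G ]
      b′ = Bias[ total≡ G c′ ∣ Δ G ]

    -- The difference vanishes because `σ` at |E| is -1 for both residues.
    bias∣Δ-symmetric : Bias[ total≡ G (#E G ℕ.+ 1) ∣ Δ G ] ≡ Bias[ total≡ G (#E G ℕ.+ 2) ∣ Δ G ]
    bias∣Δ-symmetric = begin
      b₁             ≡⟨ solve 2 (λ x y → x := (x :- y) :+ y) refl b₁ b₂ ⟩
      (b₁ - b₂) + b₂ ≡⟨ cong (_+ b₂) (2^-cancel (#E G) (2^-cancel (#E G) (begin
        p * (p * (b₁ - b₂))    ≡⟨ *-assoc p p (b₁ - b₂) ⟨
        p * p * (b₁ - b₂)      ≡⟨ bias∣Δ-gap (#E G ℕ.+ 1) (#E G ℕ.+ 2) ⟩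
        # 2 ^ rank G * ((σ (#E G ℕ.+ 1) (#E G) - σ (#E G ℕ.+ 2) (#E G)) * signedEulerianSum G)
          ≡⟨ cong (λ x → # 2 ^ rank G * (x * signedEulerianSum G)) (cong₂ _-_ (σ-+1 (#E G)) (σ-+2 (#E G))) ⟩
        # 2 ^ rank G * (0ℚ * signedEulerianSum G)
          ≡⟨ solve 3 (λ t w p → t :* (con 0ℚ :* w) := p :* (p :* con 0ℚ)) refl (# 2 ^ rank G) (signedEulerianSum G) p ⟩
        p * (p * 0ℚ)           ∎))) ⟩
      0ℚ + b₂        ≡⟨ +-identityˡ b₂ ⟩
      b₂             ∎
      where
      b₁ = Bias[ total≡ G (#E G ℕ.+ 1) ∣ Δ G ]
      b₂ = Bias[ total≡ G (#E G ℕ.+ 2) ∣ Δ G ]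

    bias-gap≢0 : NonZero (Bias[ total≡ G (#E G) ] - Bias[ total≡ G (#E G ℕ.+ 1) ])
    bias-gap≢0 = ≢-nonZero λ d≡0 → 0≢2 (trans (sym (*-zeroʳ (p * p))) (trans (cong (p * p *_) (sym d≡0)) bias-gap))
      where
      0≢2 : 0ℚ ≢ # 2
      0≢2 ()

    bias-ratio : Bias[ total≡ G (#E G) ∣ Δ G ] - Bias[ total≡ G (#E G ℕ.+ 1) ∣ Δ G ] ≡
      (Bias[ total≡ G (#E G) ] - Bias[ total≡ G (#E G ℕ.+ 1) ]) * (# 2 ^ rank G * signedEulerianSum G)
    bias-ratio = 2^-cancel μ (2^-cancel μ (begin
      p * (p * x)                                  ≡⟨ *-assoc p p x ⟨
      p * p * x                                    ≡⟨ bias∣Δ-gap μ (μ ℕ.+ 1) ⟩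
      # 2 ^ rank G * ((σ μ μ - σ (μ ℕ.+ 1) μ) * W) ≡⟨ cong (λ s → # 2 ^ rank G * (s * W)) (cong₂ _-_ (σ-≡ μ) (σ-+1 μ)) ⟩
      -- The 2 is read back as 4^|E| times the unconditional difference `d`, so the scaling cancels
      -- on both sides.
      # 2 ^ rank G * (# 2 * W)                     ≡⟨ cong (λ s → # 2 ^ rank G * (s * W)) bias-gap ⟨
      # 2 ^ rank G * (p * p * d * W)
        ≡⟨ solve 4 (λ t p d w → t :* (((p :* p) :* d) :* w) := p :* (p :* (d :* (t :* w)))) refl (# 2 ^ rank G) p d W ⟩
      p * (p * (d * (# 2 ^ rank G * W)))           ∎))
      where
      μ = #E G
      W = signedEulerianSum G
      x = Bias[ total≡ G μ ∣ Δ G ] - Bias[ total≡ G (μ ℕ.+ 1) ∣ Δ G ]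
      d = Bias[ total≡ G μ ] - Bias[ total≡ G (μ ℕ.+ 1) ]

  ÷-unique : ∀ {x y z} .{{_ : NonZero y}} → x ≡ y * z → x ÷ y ≡ z
  ÷-unique {x} {y} {z} x≡yz = begin
    x * 1/ y         ≡⟨ cong (_* 1/ y) x≡yz ⟩
    y * z * 1/ y     ≡⟨ solve 3 (λ y z i → (y :* z) :* i := (y :* i) :* z) refl y z (1/ y) ⟩
    y * 1/ y * z     ≡⟨ cong (_* z) (*-inverseʳ y) ⟩
    1ℚ * z           ≡⟨ *-identityˡ z ⟩
    z                ∎

open import Defs
open import Data.Nat.Base using (_+_)
open import Data.Integer.Base using (+_)
open import Data.Rational.Base using (ℚ; NonZero; _-_; _*_; -_; _/_; _÷_; -½)
open import Data.Product using (_×_; Σ-syntax)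
open import Relation.Binary.PropositionalEquality using (_≡_)

open import Data.Product using (_,_)
open import Relation.Binary.PropositionalEquality using (trans; sym)
open Enumeration using (÷-unique; bias∣Δ-symmetric; bias-gap≢0; bias-ratio; tutte-eulerian)

theorem2p15 : (G : Graph) → let instance ℙΔ≢0 = Δ-nonZero G in
    Bias[ total≡ G (#E G + 1) ∣ Δ G ] ≡ Bias[ total≡ G (#E G + 2) ∣ Δ G ]
    × Σ[ nz ∈ NonZero (Bias[ total≡ G (#E G) ] - Bias[ total≡ G (#E G + 1) ]) ]
    ((Bias[ total≡ G (#E G) ∣ Δ G ] - Bias[ total≡ G (#E G + 1) ∣ Δ G ])
    ÷ (Bias[ total≡ G (#E G) ] - Bias[ total≡ G (#E G + 1) ])) {{nz}}
    ≡ (+ 4 / 1) ^ rank G * (- (+ 3 / 1)) ^ nullity G * Tutte G -½ (- (+ 1 / 3))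
theorem2p15 G = bias∣Δ-symmetric G , bias-gap≢0 G , trans
  (÷-unique {{bias-gap≢0 G}} (bias-ratio G))
  (sym (tutte-eulerian G))
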